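{- Every graph $G$ with fusion-width $\mathrm{fw}(G)=k$ has clique-width $\mathrm{cw}(G)$ at most $k\,2^{k}$.
   Context: Graphs are finite, simple, undirected and nonempty. A $k$-expression is an expression built from atoms $i(v)$, unary operations $\eta_{i,j}$ and $\rho_{i\to j}$, and the binary operation $\oplus$, with labels $i,j\in\{1,\dots,k\}$, where: $i(v)$ creates a single vertex $v$ with label $i$; $\eta_{i,j}$ (for $i\neq j$) creates an edge between every vertex with label $i$ and every vertex with label $j$; $\rho_{i\to j}$ changes all labels $i$ to $j$; $\oplus$ forms the disjoint union of two labeled graphs. The generated graph is obtained by finally deleting the labels. The clique-width $\mathrm{cw}(G)$ is the smallest $k$ such that $G$ is generated by a $k$-expression. A $k$-fusion-tree expression is an expression built from atoms $i\langle m\rangle$, unary operations $\eta_{i,j}$, $\rho_{i\to j}$, $\theta_i$, and the binary operation $\oplus$, with labels $i,j\in\{1,\dots,k\}$, where: $i\langle m\rangle$ creates a graph consisting of $m$ isolated vertices labeled $i$; $\eta_{i,j}$ (for $i\ne j$) creates an edge between every vertex with label $i$ and every vertex with label $j$; $\rho_{i\to j}$ changes all labels $i$ to $j$; $\oplus$ forms the disjoint union of two labeled graphs; $\theta_i$ merges all vertices labeled $i$ into one vertex, which is labeled $i$ and is adjacent to every vertex not labeled $i$ to which some vertex labeled $i$ was adjacent before the operation. The generated graph is obtained by finally deleting all labels. The fusion-width $\mathrm{fw}(G)$ is the smallest $k$ such that there is a $k$-fusion-tree expression generating $G$. -}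

module Defs where

open import Data.Bool using (if_then_else_)
open import Data.Empty using (⊥; ⊥-elim)
open import Data.Fin using (Fin; zero; suc; _≟_; combine; remQuot; finToFun; funToFin)
open import Data.Fin.Properties
  using (any?; all?; remQuot-combine; finToFun-funToFin; suc-injective; 0≢1+n)
open import Data.Fin.Subset using (Subset; _∈_; _∪_; ⁅_⁆; _⊃_) renaming (⊥ to ∅)
open import Data.Fin.Subset.Properties
  using (_∈?_; ∉⊥; x∈⁅x⁆; x∈⁅y⁆⇒x≡y; x∈p∪q⁻; p⊆p∪q; q⊆p∪q)
open import Data.Fin.Subset.Induction using (⊃-wellFounded)
open import Data.List using (List; []; _∷_; filter; cartesianProduct; allFin)
open import Data.List.Membership.Propositional using () renaming (_∈_ to _∈ˡ_)
open import Data.List.Membership.Propositional.Properties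
  using (∈-filter⁺; ∈-filter⁻; ∈-cartesianProduct⁺; ∈-allFin)
open import Data.List.Relation.Unary.Any using (here; there)
open import Data.Nat using (ℕ; zero; suc; NonZero; _≤_; _<_; _*_; _^_)
open import Data.Nat.Induction using (<-wellFounded)
open import Data.Nat.Properties using (≮⇒≥; anyUpTo?)
open import Data.Product using (∃; _×_; _,_; proj₁; proj₂; swap)
open import Data.Sum using (_⊎_; inj₁; inj₂; [_,_]′; map)
open import Data.Sum.Relation.Binary.Pointwise
  using (Pointwise; inj₁; inj₂; drop-inj₁; drop-inj₂; ⊎-refl)
open import Function using (_∘_; id)
open import Function.Bundles using (_⇔_; mk⇔; Equivalence)
open import Function.Definitions using (Congruent; Injective; Surjective; Bijective)
open import Induction.WellFounded using (Acc; acc)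
open import Level using (0ℓ)
open import Relation.Binary using (Rel; Reflexive; Symmetric; Irreflexive; Decidable)
open import Relation.Binary.PropositionalEquality
  using (_≡_; _≢_; refl; sym; trans; cong; cong₂; subst)
open import Relation.Nullary using (¬_; Dec; yes; no; does)
open import Relation.Nullary.Decidable
  using (map′; _×-dec_; _⊎-dec_; _→-dec_; ¬?; decidable-stable)
open import Relation.Unary using (Pred) renaming (Decidable to Decidable₁)

record Graph : Set₁ where
  infix 4 _~_
  field
    order       : ℕ
    .{{nonempty}} : NonZero order
    _~_         : Rel (Fin order) 0ℓ
    ~-sym       : Symmetric _~_
    ~-irrefl    : Irreflexive _≡_ _~_
    _~?_        : Decidable _~_

-- A labelled graph whose vertices are the elements of Point up to _≈_.
-- Only fusion makes _≈_ coarser than the evident equality: the points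
-- then record the atoms from which each vertex was obtained.

record LabelledGraph (k : ℕ) : Set₁ where
  infix 4 _≈_ _~_
  field
    Point : Set
    _≈_   : Rel Point 0ℓ
    label : Point → Fin k
    _~_   : Rel Point 0ℓ

module _ {k : ℕ} where

  isolated : Fin k → ℕ → LabelledGraph k
  isolated i m = record
    { Point = Fin m
    ; _≈_   = _≡_
    ; label = λ _ → i
    ; _~_   = λ _ _ → ⊥
    }

  connect : Fin k → Fin k → LabelledGraph k → LabelledGraph k
  connect i j G = record
    { Point = Point
    ; _≈_   = _≈_
    ; label = label
    ; _~_   = λ u v → u ~ v ⊎ (label u ≡ i × label v ≡ j) ⊎ (label u ≡ j × label v ≡ i)
    }
    where open LabelledGraph G

  relabel : Fin k → Fin k → LabelledGraph k → LabelledGraph k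
  relabel i j G = record
    { Point = Point
    ; _≈_   = _≈_
    ; label = λ v → if does (label v ≟ i) then j else label v
    ; _~_   = _~_
    }
    where open LabelledGraph G

  disjointUnion : LabelledGraph k → LabelledGraph k → LabelledGraph k
  disjointUnion G H = record
    { Point = G.Point ⊎ H.Point
    ; _≈_   = Pointwise G._≈_ H._≈_
    ; label = [ G.label , H.label ]′
    ; _~_   = Pointwise G._~_ H._~_
    }
    where
    module G = LabelledGraph G
    module H = LabelledGraph H

  -- Two vertices of the result are adjacent when some of the vertices
  -- merged into them were, except that the merged vertex gets no loop.
  -- If no vertex is labelled i, the graph is unchanged.

  fuse : Fin k → LabelledGraph k → LabelledGraph k
  fuse i G = record
    { Point = Point
    ; _≈_   = _≈′_
    ; label = label
    ; _~_   = λ u v → ¬ (label u ≡ i × label v ≡ i)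
                    × ∃ λ u′ → ∃ λ v′ → u ≈′ u′ × v ≈′ v′ × u′ ~ v′
    }
    where
    open LabelledGraph G
    _≈′_ : Rel Point 0ℓ
    u ≈′ v = u ≈ v ⊎ (label u ≡ i × label v ≡ i)

-- Deleting the labels of H yields G, up to isomorphism.

record _Generates_ {k : ℕ} (H : LabelledGraph k) (G : Graph) : Set where
  private
    module H = LabelledGraph H
    module G = Graph G
  field
    to        : H.Point → Fin G.order
    to-cong   : Congruent H._≈_ _≡_ to
    bijective : Bijective H._≈_ _≡_ to
    ~-⇔       : ∀ u v → (u H.~ v) ⇔ (to u G.~ to v)

-- Graphs being generated up to isomorphism, the atom i(v) need not
-- name the vertex v: distinct atoms create distinct vertices.

data CliqueExpr (k : ℕ) : Set where
  atom : Fin k → CliqueExpr k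
  η    : (i j : Fin k) → i ≢ j → CliqueExpr k → CliqueExpr k
  ρ    : (i j : Fin k) → CliqueExpr k → CliqueExpr k
  _⊕_  : CliqueExpr k → CliqueExpr k → CliqueExpr k

⟦_⟧ᶜ : ∀ {k} → CliqueExpr k → LabelledGraph k
⟦ atom i    ⟧ᶜ = isolated i 1
⟦ η i j _ e ⟧ᶜ = connect i j ⟦ e ⟧ᶜ
⟦ ρ i j e   ⟧ᶜ = relabel i j ⟦ e ⟧ᶜ
⟦ e ⊕ f     ⟧ᶜ = disjointUnion ⟦ e ⟧ᶜ ⟦ f ⟧ᶜ

-- The atom i⟨m⟩ has m ≥ 1, since graphs are nonempty.

data FusionExpr (k : ℕ) : Set where
  atom : Fin k → (m : ℕ) .{{_ : NonZero m}} → FusionExpr k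
  η    : (i j : Fin k) → i ≢ j → FusionExpr k → FusionExpr k
  ρ    : (i j : Fin k) → FusionExpr k → FusionExpr k
  θ    : Fin k → FusionExpr k → FusionExpr k
  _⊕_  : FusionExpr k → FusionExpr k → FusionExpr k

⟦_⟧ᶠ : ∀ {k} → FusionExpr k → LabelledGraph k
⟦ atom i m  ⟧ᶠ = isolated i m
⟦ η i j _ e ⟧ᶠ = connect i j ⟦ e ⟧ᶠ
⟦ ρ i j e   ⟧ᶠ = relabel i j ⟦ e ⟧ᶠ
⟦ θ i e     ⟧ᶠ = fuse i ⟦ e ⟧ᶠ
⟦ e ⊕ f     ⟧ᶠ = disjointUnion ⟦ e ⟧ᶠ ⟦ f ⟧ᶠ

IsLeast : Pred ℕ 0ℓ → Pred ℕ 0ℓ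
IsLeast P k = P k × (∀ {j} → P j → k ≤ j)

HasCliqueExpr : Graph → Pred ℕ 0ℓ
HasCliqueExpr G k = ∃ λ (e : CliqueExpr k) → ⟦ e ⟧ᶜ Generates G

HasFusionExpr : Graph → Pred ℕ 0ℓ
HasFusionExpr G k = ∃ λ (e : FusionExpr k) → ⟦ e ⟧ᶠ Generates G

IsCliqueWidth : Graph → Pred ℕ 0ℓ
IsCliqueWidth G = IsLeast (HasCliqueExpr G)

IsFusionWidth : Graph → Pred ℕ 0ℓ
IsFusionWidth G = IsLeast (HasFusionExpr G)

-- The clique-width exists constructively because HasCliqueExpr G is
-- decidable and holds of the order of G.
--
-- A State describes what an expression has built so far on a fixed set
-- of n vertices: lab x is zero if x is not yet present, and suc i if x
-- carries the label i.  There are finitely many states, so the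
-- realisable ones can be computed by saturation.

_⇔-dec_ : ∀ {A B : Set} → Dec A → Dec B → Dec (A ⇔ B)
A? ⇔-dec B? = map′ (λ (f , g) → mk⇔ f g) (λ h → Equivalence.to h , Equivalence.from h)
                   ((A? →-dec B?) ×-dec (B? →-dec A?))

≈-reflᶜ : ∀ {k} (e : CliqueExpr k) → Reflexive (LabelledGraph._≈_ ⟦ e ⟧ᶜ)
≈-reflᶜ (atom i)    = refl
≈-reflᶜ (η i j _ e) = ≈-reflᶜ e
≈-reflᶜ (ρ i j e)   = ≈-reflᶜ e
≈-reflᶜ (e ⊕ f)     = ⊎-refl (≈-reflᶜ e) (≈-reflᶜ f)

least : ∀ {P : Pred ℕ 0ℓ} → Decidable₁ P → ∀ n → P n → ∃ (IsLeast P)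
least {P} P? n pn = go n pn (<-wellFounded n)
  where
  go : ∀ n → P n → Acc _<_ n → ∃ (IsLeast P)
  go n pn (acc rs) with anyUpTo? P? n
  ... | yes (m , m<n , pm) = go m pm (rs m<n)
  ... | no none            = n , pn , λ pj → ≮⇒≥ λ j<n → none (_ , j<n , pj)

saturate : ∀ {N} (Step : Subset N → Pred (Fin N) 0ℓ) → (∀ p → Decidable₁ (Step p)) →
           (Good : Pred (Fin N) 0ℓ) →
           (∀ p → (∀ {d} → d ∈ p → Good d) → ∀ {c} → Step p c → Good c) →
           ∃ λ p → (∀ {d} → d ∈ p → Good d) × (∀ {c} → Step p c → c ∈ p)
saturate {N} Step step? Good sound = go ∅ (λ d∈∅ → ⊥-elim (∉⊥ d∈∅)) (⊃-wellFounded ∅)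
  where
  go : ∀ p → (∀ {d} → d ∈ p → Good d) → Acc _⊃_ p →
       ∃ λ p → (∀ {d} → d ∈ p → Good d) × (∀ {c} → Step p c → c ∈ p)
  go p good (acc rs) with any? (λ c → step? p c ×-dec ¬? (c ∈? p))
  ... | yes (c , st , c∉p) = go (p ∪ ⁅ c ⁆) good′ (rs (p⊆p∪q _ , c , q⊆p∪q p _ (x∈⁅x⁆ c) , c∉p))
    where
    good′ : ∀ {d} → d ∈ p ∪ ⁅ c ⁆ → Good d
    good′ d∈ with x∈p∪q⁻ p ⁅ c ⁆ d∈
    ... | inj₁ d∈p = good d∈p
    ... | inj₂ d∈c = subst Good (sym (x∈⁅y⁆⇒x≡y _ d∈c)) (sound p good st)
  ... | no none = p , good , λ {c} st → decidable-stable (c ∈? p) λ c∉p → none (c , st , c∉p)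

module _ {k n : ℕ} where

  record State : Set₁ where
    field
      lab   : Fin n → Fin (suc k)
      Edge  : Rel (Fin n) 0ℓ
      edge? : Decidable Edge

  open State

  infix 4 _≐_
  record _≐_ (s t : State) : Set where
    constructor mk≐
    field
      lab-≡  : ∀ x → lab s x ≡ lab t x
      Edge-⇔ : ∀ x y → Edge s x y ⇔ Edge t x y

  infix 4 _≐?_
  _≐?_ : Decidable _≐_
  s ≐? t = map′ (λ (l , e) → mk≐ l e) (λ (mk≐ l e) → l , e)
    (all? (λ x → lab s x ≟ lab t x) ×-dec all? (λ x → all? λ y → edge? s x y ⇔-dec edge? t x y))

  Code : Set
  Code = Fin (suc k ^ n * (2 ^ n) ^ n)

  decode : Code → State
  decode c = record
    { lab   = finToFun (proj₁ parts)
    ; Edge  = λ x y → finToFun {2} (finToFun (proj₂ parts) x) y ≡ suc zero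
    ; edge? = λ x y → finToFun {2} (finToFun (proj₂ parts) x) y ≟ suc zero
    }
    where parts = remQuot {suc k ^ n} ((2 ^ n) ^ n) c

  bit : ∀ {A : Set} → Dec A → Fin 2
  bit (yes _) = suc zero
  bit (no _)  = zero

  bit-⇔ : ∀ {A : Set} (A? : Dec A) → bit A? ≡ suc zero ⇔ A
  bit-⇔ (yes a) = mk⇔ (λ _ → a) (λ _ → refl)
  bit-⇔ (no ¬a) = mk⇔ (λ ()) (λ a → ⊥-elim (¬a a))

  encode : State → Code
  encode s = combine (funToFin (lab s)) (funToFin λ x → funToFin λ y → bit (edge? s x y))

  decode-encode : ∀ s → s ≐ decode (encode s)
  decode-encode s = mk≐ labs λ x y → mk⇔
      (λ e → trans (bits x y) (Equivalence.from (bit-⇔ (edge? s x y)) e))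
      (λ e → Equivalence.to (bit-⇔ (edge? s x y)) (trans (sym (bits x y)) e))
    where
    row : Fin n → Fin (2 ^ n)
    row x = funToFin λ y → bit (edge? s x y)
    parts : remQuot {suc k ^ n} ((2 ^ n) ^ n) (encode s) ≡ (funToFin (lab s) , funToFin row)
    parts = remQuot-combine (funToFin (lab s)) (funToFin row)
    labs : ∀ x → lab s x ≡ lab (decode (encode s)) x
    labs x = sym (trans (cong (λ q → finToFun (proj₁ q) x) parts) (finToFun-funToFin (lab s) x))
    bits : ∀ x y → finToFun {2} (finToFun (proj₂ (remQuot {suc k ^ n} ((2 ^ n) ^ n) (encode s))) x) y
                 ≡ bit (edge? s x y)
    bits x y = trans (cong (λ q → finToFun {2} (finToFun (proj₂ q) x) y) parts)
      (trans (cong (λ c → finToFun {2} {n} c y) (finToFun-funToFin row x))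
             (finToFun-funToFin (λ y → bit (edge? s x y)) y))

  atomˢ : Fin k → Fin n → State
  atomˢ i x = record
    { lab   = λ y → if does (y ≟ x) then suc i else zero
    ; Edge  = λ _ _ → ⊥
    ; edge? = λ _ _ → no λ ()
    }

  ηˢ : Fin k → Fin k → State → State
  ηˢ i j s = record
    { lab   = lab s
    ; Edge  = λ x y → Edge s x y ⊎ (lab s x ≡ suc i × lab s y ≡ suc j)
                                 ⊎ (lab s x ≡ suc j × lab s y ≡ suc i)
    ; edge? = λ x y → edge? s x y ⊎-dec (lab s x ≟ suc i ×-dec lab s y ≟ suc j)
                                  ⊎-dec (lab s x ≟ suc j ×-dec lab s y ≟ suc i)
    }

  ρ-lab : Fin k → Fin k → Fin (suc k) → Fin (suc k)
  ρ-lab i j zero    = zero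
  ρ-lab i j (suc l) = suc (if does (l ≟ i) then j else l)

  ρˢ : Fin k → Fin k → State → State
  ρˢ i j s = record { lab = ρ-lab i j ∘ lab s ; Edge = Edge s ; edge? = edge? s }

  ⊕-lab : Fin (suc k) → Fin (suc k) → Fin (suc k)
  ⊕-lab zero    l = l
  ⊕-lab (suc l) _ = suc l

  infix 5 _⊕ˢ_
  _⊕ˢ_ : State → State → State
  s ⊕ˢ t = record
    { lab   = λ x → ⊕-lab (lab s x) (lab t x)
    ; Edge  = λ x y → Edge s x y ⊎ Edge t x y
    ; edge? = λ x y → edge? s x y ⊎-dec edge? t x y
    }

  Disjoint : Rel State 0ℓ
  Disjoint s t = ∀ x → lab s x ≡ zero ⊎ lab t x ≡ zero

  -- The vertices of H, placed by to, are described by s.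

  record Shows (H : LabelledGraph k) (to : LabelledGraph.Point H → Fin n) (s : State) : Set where
    open LabelledGraph H
    field
      to-cong : Congruent _≈_ _≡_ to
      to-inj  : Injective _≈_ _≡_ to
      lab-to  : ∀ v → lab s (to v) ≡ suc (label v)
      present : ∀ x → lab s x ≡ zero ⊎ ∃ λ v → to v ≡ x
      edge    : ∀ u v → (u ~ v) ⇔ Edge s (to u) (to v)
      edge-in : ∀ {x y} → Edge s x y → lab s x ≢ zero × lab s y ≢ zero

  open Shows

  shows-≐ : ∀ {H to s t} → s ≐ t → Shows H to s → Shows H to t
  shows-≐ (mk≐ l e) S = record
    { to-cong = to-cong S
    ; to-inj  = to-inj S
    ; lab-to  = λ v → trans (sym (l _)) (lab-to S v)
    ; present = λ x → [ (λ z → inj₁ (trans (sym (l x)) z)) , inj₂ ]′ (present S x)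
    ; edge    = λ u v → mk⇔
        (Equivalence.to (e _ _) ∘ Equivalence.to (edge S u v))
        (Equivalence.from (edge S u v) ∘ Equivalence.from (e _ _))
    ; edge-in = λ {x} {y} xy → let (p , q) = edge-in S (Equivalence.from (e _ _) xy) in
        (λ z → p (trans (l x) z)) , (λ z → q (trans (l y) z))
    }

  ≐-sym : ∀ {s t} → s ≐ t → t ≐ s
  ≐-sym (mk≐ l e) = mk≐ (λ x → sym (l x)) λ x y → mk⇔ (Equivalence.from (e x y)) (Equivalence.to (e x y))

  shows-atom : ∀ i (to : Fin 1 → Fin n) → Shows (isolated i 1) to (atomˢ i (to zero))
  shows-atom i to = record
    { to-cong = cong to
    ; to-inj  = λ { {zero} {zero} _ → refl }
    ; lab-to  = λ { zero → lab-self }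
    ; present = pres
    ; edge    = λ _ _ → mk⇔ (λ ()) (λ ())
    ; edge-in = λ ()
    }
    where
    lab-self : lab (atomˢ i (to zero)) (to zero) ≡ suc i
    lab-self with to zero ≟ to zero
    ... | yes _ = refl
    ... | no ≢  = ⊥-elim (≢ refl)
    pres : ∀ x → lab (atomˢ i (to zero)) x ≡ zero ⊎ ∃ λ v → to v ≡ x
    pres x with x ≟ to zero
    ... | yes eq = inj₂ (zero , sym eq)
    ... | no _   = inj₁ refl

  shows-η : ∀ {H to s} i j → Shows H to s → Shows (connect i j H) to (ηˢ i j s)
  shows-η {H} {to} {s} i j S = record
    { to-cong = to-cong S
    ; to-inj  = to-inj S
    ; lab-to  = lab-to S
    ; present = present S
    ; edge    = λ u v → mk⇔
        [ inj₁ ∘ Equivalence.to (edge S u v) , inj₂ ∘ [ inj₁ ∘ fwd , inj₂ ∘ fwd ]′ ]′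
        [ (λ e → inj₁ (Equivalence.from (edge S u v) e)) , inj₂ ∘ [ inj₁ ∘ bwd , inj₂ ∘ bwd ]′ ]′
    ; edge-in = [ edge-in S , [ both , both ]′ ]′
    }
    where
    open LabelledGraph H using (label)
    fwd : ∀ {u v a b} → label u ≡ a × label v ≡ b → lab s (to u) ≡ suc a × lab s (to v) ≡ suc b
    fwd (p , q) = trans (lab-to S _) (cong suc p) , trans (lab-to S _) (cong suc q)
    bwd : ∀ {u v a b} → lab s (to u) ≡ suc a × lab s (to v) ≡ suc b → label u ≡ a × label v ≡ b
    bwd (p , q) = suc-injective (trans (sym (lab-to S _)) p) , suc-injective (trans (sym (lab-to S _)) q)
    both : ∀ {x y a b} → lab s x ≡ suc a × lab s y ≡ suc b → lab s x ≢ zero × lab s y ≢ zero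
    both (p , q) = (λ z → 0≢1+n (trans (sym z) p)) , (λ z → 0≢1+n (trans (sym z) q))

  shows-ρ : ∀ {H to s} i j → Shows H to s → Shows (relabel i j H) to (ρˢ i j s)
  shows-ρ {s = s} i j S = record
    { to-cong = to-cong S
    ; to-inj  = to-inj S
    ; lab-to  = λ v → cong (ρ-lab i j) (lab-to S v)
    ; present = λ x → [ inj₁ ∘ cong (ρ-lab i j) , inj₂ ]′ (present S x)
    ; edge    = edge S
    ; edge-in = λ xy → let (p , q) = edge-in S xy in p ∘ unzero _ , q ∘ unzero _
    }
    where
    unzero : ∀ l → ρ-lab i j l ≡ zero → l ≡ zero
    unzero zero _ = refl

  shows-⊕ : ∀ {G H s t} {to : LabelledGraph.Point G ⊎ LabelledGraph.Point H → Fin n} →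
            Disjoint s t → Shows G (to ∘ inj₁) s → Shows H (to ∘ inj₂) t →
            Shows (disjointUnion G H) to (s ⊕ˢ t)
  shows-⊕ {G} {H} {s} {t} {to} dis S T = record
    { to-cong = λ { (inj₁ e) → to-cong S e ; (inj₂ e) → to-cong T e }
    ; to-inj  = λ { {inj₁ u} {inj₁ v} e → inj₁ (to-inj S e)
                  ; {inj₁ u} {inj₂ v} e → ⊥-elim (apart e)
                  ; {inj₂ u} {inj₁ v} e → ⊥-elim (apart (sym e))
                  ; {inj₂ u} {inj₂ v} e → inj₂ (to-inj T e) }
    ; lab-to  = λ { (inj₁ u) → inS (lab-to S u) ; (inj₂ v) → inT (lab-to T v) }
    ; present = pres
    ; edge    = λ
        { (inj₁ u) (inj₁ v) → mk⇔ (λ { (inj₁ e) → inj₁ (Equivalence.to (edge S u v) e) })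
            [ inj₁ ∘ Equivalence.from (edge S u v) , (λ e → ⊥-elim (proj₁ (edge-in T e) (offT u))) ]′
        ; (inj₁ u) (inj₂ v) → mk⇔ (λ ())
            [ (λ e → ⊥-elim (proj₂ (edge-in S e) (offS v))) , (λ e → ⊥-elim (proj₁ (edge-in T e) (offT u))) ]′
        ; (inj₂ u) (inj₁ v) → mk⇔ (λ ())
            [ (λ e → ⊥-elim (proj₁ (edge-in S e) (offS u))) , (λ e → ⊥-elim (proj₂ (edge-in T e) (offT v))) ]′
        ; (inj₂ u) (inj₂ v) → mk⇔ (λ { (inj₂ e) → inj₂ (Equivalence.to (edge T u v) e) })
            [ (λ e → ⊥-elim (proj₁ (edge-in S e) (offS u))) , inj₂ ∘ Equivalence.from (edge T u v) ]′
        }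
    ; edge-in = [ (λ e → let (p , q) = edge-in S e in p ∘ left , q ∘ left)
                , (λ e → let (p , q) = edge-in T e in p ∘ right , q ∘ right) ]′
    }
    where
    module G = LabelledGraph G
    module H = LabelledGraph H
    offT : ∀ u → lab t (to (inj₁ u)) ≡ zero
    offT u with dis (to (inj₁ u))
    ... | inj₁ z = ⊥-elim (0≢1+n (trans (sym z) (lab-to S u)))
    ... | inj₂ z = z
    offS : ∀ v → lab s (to (inj₂ v)) ≡ zero
    offS v with dis (to (inj₂ v))
    ... | inj₁ z = z
    ... | inj₂ z = ⊥-elim (0≢1+n (trans (sym z) (lab-to T v)))
    apart : ∀ {u v} → ¬ (to (inj₁ u) ≡ to (inj₂ v))
    apart {u} {v} e = 0≢1+n (trans (sym (offS v)) (trans (sym (cong (lab s) e)) (lab-to S u)))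
    inS : ∀ {x l} → lab s x ≡ suc l → ⊕-lab (lab s x) (lab t x) ≡ suc l
    inS e rewrite e = refl
    inT : ∀ {x l} → lab t x ≡ suc l → ⊕-lab (lab s x) (lab t x) ≡ suc l
    inT {x} e with dis x
    ... | inj₁ z rewrite z = e
    ... | inj₂ z = ⊥-elim (0≢1+n (trans (sym z) e))
    left : ∀ {x} → ⊕-lab (lab s x) (lab t x) ≡ zero → lab s x ≡ zero
    left {x} e with zero ← lab s x = refl
    right : ∀ {x} → ⊕-lab (lab s x) (lab t x) ≡ zero → lab t x ≡ zero
    right {x} e with zero ← lab s x = e
    pres : ∀ x → ⊕-lab (lab s x) (lab t x) ≡ zero ⊎ ∃ λ v → to v ≡ x
    pres x with present S x | present T x
    ... | inj₂ (v , e) | _            = inj₂ (inj₁ v , e)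
    ... | inj₁ _       | inj₂ (v , e) = inj₂ (inj₂ v , e)
    ... | inj₁ y       | inj₁ z rewrite y = inj₁ z

  Realisable : Pred Code 0ℓ
  Realisable c = ∃ λ (e : CliqueExpr k) → ∃ λ to → Shows ⟦ e ⟧ᶜ to (decode c)

  Step : Subset (suc k ^ n * (2 ^ n) ^ n) → Pred Code 0ℓ
  Step p c =
      (∃ λ i → ∃ λ x → decode c ≐ atomˢ i x)
    ⊎ (∃ λ d → d ∈ p × ∃ λ i → ∃ λ j → i ≢ j × decode c ≐ ηˢ i j (decode d))
    ⊎ (∃ λ d → d ∈ p × ∃ λ i → ∃ λ j → decode c ≐ ρˢ i j (decode d))
    ⊎ (∃ λ d → d ∈ p × ∃ λ d′ → d′ ∈ p × Disjoint (decode d) (decode d′)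
                                       × decode c ≐ decode d ⊕ˢ decode d′)

  step? : ∀ p → Decidable₁ (Step p)
  step? p c =
          any? (λ i → any? λ x → decode c ≐? atomˢ i x)
    ⊎-dec any? (λ d → d ∈? p ×-dec any? λ i → any? λ j → ¬? (i ≟ j) ×-dec decode c ≐? ηˢ i j (decode d))
    ⊎-dec any? (λ d → d ∈? p ×-dec any? λ i → any? λ j → decode c ≐? ρˢ i j (decode d))
    ⊎-dec any? (λ d → d ∈? p ×-dec any? λ d′ → d′ ∈? p
            ×-dec all? (λ x → lab (decode d) x ≟ zero ⊎-dec lab (decode d′) x ≟ zero)
            ×-dec decode c ≐? decode d ⊕ˢ decode d′)

  sound : ∀ p → (∀ {d} → d ∈ p → Realisable d) → ∀ {c} → Step p c → Realisable c
  sound p good (inj₁ (i , x , eq)) =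
    atom i , (λ _ → x) , shows-≐ (≐-sym eq) (shows-atom i (λ _ → x))
  sound p good (inj₂ (inj₁ (d , d∈p , i , j , i≢j , eq))) =
    let (e , to , S) = good d∈p in η i j i≢j e , to , shows-≐ (≐-sym eq) (shows-η i j S)
  sound p good (inj₂ (inj₂ (inj₁ (d , d∈p , i , j , eq)))) =
    let (e , to , S) = good d∈p in ρ i j e , to , shows-≐ (≐-sym eq) (shows-ρ i j S)
  sound p good (inj₂ (inj₂ (inj₂ (d , d∈p , d′ , d′∈p , dis , eq)))) =
    let (e , f , S) = good d∈p
        (e′ , g , T) = good d′∈p
    in e ⊕ e′ , [ f , g ]′ , shows-≐ (≐-sym eq) (shows-⊕ dis S T)

  realisable : ∃ λ p → (∀ {c} → c ∈ p → Realisable c) × (∀ {c} → Step p c → c ∈ p)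
  realisable = saturate Step step? Realisable sound

  complete : ∀ {p} → (∀ {c} → Step p c → c ∈ p) → (e : CliqueExpr k) →
             let open LabelledGraph ⟦ e ⟧ᶜ in
             (to : Point → Fin n) → Congruent _≈_ _≡_ to → Injective _≈_ _≡_ to →
             ∃ λ c → c ∈ p × Shows ⟦ e ⟧ᶜ to (decode c)
  complete {p} closed = go
    where
    add : ∀ {H to} s → Shows H to s → (∀ {c} → decode c ≐ s → Step p c) →
          ∃ λ c → c ∈ p × Shows H to (decode c)
    add s S st = encode s , closed (st (≐-sym (decode-encode s))) , shows-≐ (decode-encode s) S

    go : (e : CliqueExpr k) → let open LabelledGraph ⟦ e ⟧ᶜ in
         (to : Point → Fin n) → Congruent _≈_ _≡_ to → Injective _≈_ _≡_ to →
         ∃ λ c → c ∈ p × Shows ⟦ e ⟧ᶜ to (decode c)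
    go (atom i) to _ _ = add _ (shows-atom i to) (λ eq → inj₁ (i , to zero , eq))
    go (η i j i≢j e) to cg inj with d , d∈p , S ← go e to cg inj =
      add _ (shows-η i j S) (λ eq → inj₂ (inj₁ (d , d∈p , i , j , i≢j , eq)))
    go (ρ i j e) to cg inj with d , d∈p , S ← go e to cg inj =
      add _ (shows-ρ i j S) (λ eq → inj₂ (inj₂ (inj₁ (d , d∈p , i , j , eq))))
    go (e ⊕ f) to cg inj
      with d , d∈p , S ← go e (to ∘ inj₁) (cg ∘ inj₁) (drop-inj₁ ∘ inj)
         | d′ , d′∈p , T ← go f (to ∘ inj₂) (cg ∘ inj₂) (drop-inj₂ ∘ inj)
      = add _ (shows-⊕ dis S T) (λ eq → inj₂ (inj₂ (inj₂ (d , d∈p , d′ , d′∈p , dis , eq))))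
      where
      dis : Disjoint (decode d) (decode d′)
      dis x with present S x | present T x
      ... | inj₁ z | _ = inj₁ z
      ... | inj₂ _ | inj₁ z = inj₂ z
      ... | inj₂ (u , p) | inj₂ (v , q) with () ← inj {inj₁ u} {inj₂ v} (trans p (sym q))

module _ (G : Graph) where
  open Graph G

  hasCliqueExpr? : Decidable₁ (HasCliqueExpr G)
  hasCliqueExpr? k with p , good , closed ← realisable {k} {order} =
    map′ from-state to-state (any? λ c → c ∈? p ×-dec full? c)
    where
    Full : Pred (Code {k} {order}) 0ℓ
    Full c = (∀ x → State.lab (decode c) x ≢ zero)
           × (∀ x y → State.Edge (decode c) x y ⇔ (x ~ y))
    full? : Decidable₁ Full
    full? c = all? (λ x → ¬? (State.lab (decode c) x ≟ zero))
      ×-dec all? (λ x → all? λ y → State.edge? (decode c) x y ⇔-dec (x ~? y))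

    from-state : (∃ λ c → c ∈ p × Full c) → HasCliqueExpr G k
    from-state (c , c∈p , total , edges) with e , to , S ← good c∈p = e , record
      { to        = to
      ; to-cong   = Shows.to-cong S
      ; bijective = Shows.to-inj S , surj
      ; ~-⇔       = λ u v → mk⇔
          (Equivalence.to (edges _ _) ∘ Equivalence.to (Shows.edge S u v))
          (Equivalence.from (Shows.edge S u v) ∘ Equivalence.from (edges _ _))
      }
      where
      surj : Surjective (LabelledGraph._≈_ ⟦ e ⟧ᶜ) _≡_ to
      surj x with Shows.present S x
      ... | inj₁ z        = ⊥-elim (total x z)
      ... | inj₂ (v , eq) = v , λ z≈v → trans (Shows.to-cong S z≈v) eq

    to-state : HasCliqueExpr G k → ∃ λ c → c ∈ p × Full c
    to-state (e , gen)
      with c , c∈p , S ← complete closed e (_Generates_.to gen) (_Generates_.to-cong gen)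
                           (proj₁ (_Generates_.bijective gen))
      = c , c∈p , total , edges
      where
      open _Generates_ gen
      hit : ∀ x → ∃ λ v → to v ≡ x
      hit x = let (v , h) = proj₂ bijective x in v , h (≈-reflᶜ e)
      total : ∀ x → State.lab (decode c) x ≢ zero
      total x z with v , refl ← hit x = 0≢1+n (trans (sym z) (Shows.lab-to S v))
      edges : ∀ x y → State.Edge (decode c) x y ⇔ (x ~ y)
      edges x y with u , refl ← hit x | v , refl ← hit y = mk⇔
        (Equivalence.to (~-⇔ u v) ∘ Equivalence.from (Shows.edge S u v))
        (Equivalence.to (Shows.edge S u v) ∘ Equivalence.from (~-⇔ u v))

-- With one label per vertex, every graph has an expression.

record Draws {k n : ℕ} (f : Fin n → Fin k) (L : List (Fin n × Fin n)) (H : LabelledGraph k) : Set where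
  open LabelledGraph H using (Point; _≈_; label) renaming (_~_ to _~ᴴ_)
  field
    to        : Point → Fin n
    to-cong   : Congruent _≈_ _≡_ to
    bijective : Bijective _≈_ _≡_ to
    label-to  : ∀ v → label v ≡ f (to v)
    edge      : ∀ u v → (u ~ᴴ v) ⇔ ((to u , to v) ∈ˡ L ⊎ (to v , to u) ∈ˡ L)

draw-vertices : ∀ {k n} .{{_ : NonZero n}} (f : Fin n → Fin k) →
                ∃ λ (e : CliqueExpr k) → Draws f [] ⟦ e ⟧ᶜ
draw-vertices {n = suc zero} f = atom (f zero) , record
  { to        = λ v → v
  ; to-cong   = λ eq → eq
  ; bijective = (λ eq → eq) , λ y → y , λ eq → eq
  ; label-to  = λ { zero → refl }
  ; edge      = λ _ _ → mk⇔ (λ ()) [ (λ ()) , (λ ()) ]′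
  }
draw-vertices {n = suc (suc m)} f with e , D ← draw-vertices (f ∘ suc) = atom (f zero) ⊕ e , record
  { to        = to⁺
  ; to-cong   = λ { (inj₁ _) → refl ; (inj₂ eq) → cong suc (to-cong eq) }
  ; bijective = (λ { {inj₁ zero} {inj₁ zero} _ → inj₁ refl
                   ; {inj₂ _} {inj₂ _} eq → inj₂ (proj₁ bijective (suc-injective eq)) })
              , λ { zero    → inj₁ zero , λ { (inj₁ _) → refl }
                  ; (suc y) → inj₂ (proj₁ (proj₂ bijective y))
                            , λ { (inj₂ eq) → cong suc (proj₂ (proj₂ bijective y) eq) } }
  ; label-to  = λ { (inj₁ _) → refl ; (inj₂ v) → label-to v }
  ; edge      = λ _ _ → mk⇔ none [ (λ ()) , (λ ()) ]′
  }
  where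
  open Draws D
  to⁺ : Fin 1 ⊎ LabelledGraph.Point ⟦ e ⟧ᶜ → Fin (suc (suc m))
  to⁺ = [ (λ _ → zero) , suc ∘ to ]′
  none : ∀ {u v} → LabelledGraph._~_ ⟦ atom (f zero) ⊕ e ⟧ᶜ u v →
         (to⁺ u , to⁺ v) ∈ˡ [] ⊎ (to⁺ v , to⁺ u) ∈ˡ []
  none (inj₂ uv) with Equivalence.to (edge _ _) uv
  ... | inj₁ ()
  ... | inj₂ ()

draw-edges : ∀ {n} .{{_ : NonZero n}} (L : List (Fin n × Fin n)) →
             (∀ {x y} → (x , y) ∈ˡ L → x ≢ y) →
             ∃ λ (e : CliqueExpr n) → Draws id L ⟦ e ⟧ᶜ
draw-edges []            loopless = draw-vertices id
draw-edges ((x , y) ∷ L) loopless with e , D ← draw-edges L (loopless ∘ there) =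
  η x y (loopless (here refl)) e , record
  { to        = to
  ; to-cong   = to-cong
  ; bijective = bijective
  ; label-to  = label-to
  ; edge      = λ u v → mk⇔
      [ map there there ∘ Equivalence.to (edge u v)
      , map (λ (p , q) → here (at p q)) (λ (p , q) → here (at q p)) ]′
      [ (λ { (here eq) → inj₂ (inj₁ (of eq)) ; (there m) → inj₁ (Equivalence.from (edge u v) (inj₁ m)) })
      , (λ { (here eq) → inj₂ (inj₂ (swap (of eq)))
           ; (there m) → inj₁ (Equivalence.from (edge u v) (inj₂ m)) }) ]′
  }
  where
  open Draws D
  open LabelledGraph ⟦ e ⟧ᶜ using (label)
  at : ∀ {u v} → label u ≡ x → label v ≡ y → (to u , to v) ≡ (x , y)
  at p q = cong₂ _,_ (trans (sym (label-to _)) p) (trans (sym (label-to _)) q)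
  of : ∀ {u v} → (to u , to v) ≡ (x , y) → label u ≡ x × label v ≡ y
  of eq = trans (label-to _) (cong proj₁ eq) , trans (label-to _) (cong proj₂ eq)

hasCliqueExpr-order : ∀ G → HasCliqueExpr G (Graph.order G)
hasCliqueExpr-order G = e , record
  { to        = to
  ; to-cong   = to-cong
  ; bijective = bijective
  ; ~-⇔       = λ u v → mk⇔
      ([ ∈-edges⁻ , ~-sym ∘ ∈-edges⁻ ]′ ∘ Equivalence.to (edge u v))
      (λ uv → Equivalence.from (edge u v)
        (inj₁ (∈-filter⁺ adj? (∈-cartesianProduct⁺ (∈-allFin _) (∈-allFin _)) uv)))
  }
  where
  open Graph G
  adj? : Decidable₁ (λ (x , y) → x ~ y)
  adj? (x , y) = x ~? y
  pairs = cartesianProduct (allFin order) (allFin order)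
  ∈-edges⁻ : ∀ {x y} → (x , y) ∈ˡ filter adj? pairs → x ~ y
  ∈-edges⁻ m = proj₂ (∈-filter⁻ adj? {xs = pairs} m)
  drawing = draw-edges (filter adj? pairs) (λ m eq → ~-irrefl eq (∈-edges⁻ m))
  e = proj₁ drawing
  open Draws (proj₂ drawing)

abstract
  cliqueWidth : ∀ G → ∃ (IsCliqueWidth G)
  cliqueWidth G = least (hasCliqueExpr? G) (Graph.order G) (hasCliqueExpr-order G)

cw : Graph → ℕ
cw G = proj₁ (cliqueWidth G)

cw-isCliqueWidth : ∀ G → IsCliqueWidth G (cw G)
cw-isCliqueWidth G = proj₂ (cliqueWidth G)

{-# OPTIONS --safe #-}

-- Process a fusion-tree expression top-down, remembering for each
-- subexpression the set F of labels whose vertices are fused later on.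
-- The clique expression for the subexpression only creates the vertices
-- with labels outside F: such a vertex labelled l gets the label (l , S),
-- where S ⊆ F is the set of those labels in F at which it has a
-- neighbour.  A fused vertex is created at its last fusion θ i, with a
-- label (i , S) that is unused at that moment because i belonged to F
-- before, and is joined to the vertices whose set contains i.

module Submission where

open import Defs
open import Data.Bool using (if_then_else_)
open import Data.Empty using (⊥-elim)
open import Data.Fin using (Fin; zero; suc; _≟_; combine; remQuot; finToFun; funToFin)
open import Data.Fin.Properties
  using (any?; remQuot-combine; combine-remQuot; finToFun-funToFin; funToFin-finToFin)
open import Data.List using (List; []; _∷_; filter; cartesianProduct; allFin)
open import Data.List.Membership.Propositional using (_∈_)
open import Data.List.Membership.Propositional.Properties
  using (∈-filter⁺; ∈-filter⁻; ∈-cartesianProduct⁺; ∈-allFin)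
open import Data.List.Relation.Unary.Any using (here; there)
open import Data.Nat using (ℕ; zero; suc; NonZero; _≤_; _*_; _^_)
open import Data.Product using (∃; _×_; _,_; proj₁; proj₂; swap)
open import Data.Sum using (_⊎_; inj₁; inj₂; [_,_]′) renaming (map to ⊎-map; swap to ⊎-swap)
open import Data.Sum.Relation.Binary.Pointwise
  using (inj₁; inj₂; ⊎-isEquivalence; ⊎-decidable; ⊎-symmetric)
open import Function using (_∘_; id; case_of_)
open import Function.Bundles using (_⇔_; mk⇔; Equivalence)
open import Function.Properties.Equivalence using ()
  renaming (refl to ⇔-refl; trans to ⇔-trans)
open import Level using (0ℓ)
open import Relation.Binary
  using (Rel; Symmetric; Irreflexive; Transitive; IsEquivalence; Decidable; _Respectsˡ_)
open import Relation.Binary.PropositionalEquality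
  using (_≡_; _≢_; refl; sym; trans; cong; cong₂; subst; isEquivalence)
open import Relation.Nullary using (¬_; Dec; yes; no; does)
open import Relation.Nullary.Decidable using (map′; _×-dec_; _⊎-dec_; ¬?)
open import Relation.Unary using (Pred; ∅) renaming (Decidable to Decidable₁)

open Equivalence using () renaming (to to fwd; from to bwd)

-- Labels paired with sets of labels.

module Encoding (k : ℕ) where

  -- The labels (l , S) with S ⊆ Fin k: l is base x, and j ∈ S is j ∈ₗ x.

  PairLabel : Set
  PairLabel = Fin (k * 2 ^ k)

  base : PairLabel → Fin k
  base x = proj₁ (remQuot {k} (2 ^ k) x)

  bits : PairLabel → Fin k → Fin 2
  bits x = finToFun (proj₂ (remQuot {k} (2 ^ k) x))

  infix 4 _∈ₗ_
  _∈ₗ_ : Fin k → PairLabel → Set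
  l ∈ₗ x = bits x l ≡ suc zero

  _∈ₗ?_ : Decidable _∈ₗ_
  l ∈ₗ? x = bits x l ≟ suc zero

  bitOf : ∀ {A : Set} → Dec A → Fin 2
  bitOf A? = if does A? then suc zero else zero

  bitOf-⇔ : ∀ {A : Set} (A? : Dec A) → bitOf A? ≡ suc zero ⇔ A
  bitOf-⇔ (yes a) = mk⇔ (λ _ → a) (λ _ → refl)
  bitOf-⇔ (no ¬a) = mk⇔ (λ ()) (λ a → ⊥-elim (¬a a))

  tag : ∀ {P : Pred (Fin k) 0ℓ} → Fin k → Decidable₁ P → PairLabel
  tag l P? = combine l (funToFin (bitOf ∘ P?))

  module _ {P : Pred (Fin k) 0ℓ} (l : Fin k) (P? : Decidable₁ P) where

    private
      parts : remQuot {k} (2 ^ k) (tag l P?) ≡ (l , funToFin (bitOf ∘ P?))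
      parts = remQuot-combine l (funToFin (bitOf ∘ P?))

    base-tag : base (tag l P?) ≡ l
    base-tag = cong proj₁ parts

    ∈-tag : ∀ {j} → j ∈ₗ tag l P? ⇔ P j
    ∈-tag {j} = mk⇔ (λ e → fwd (bitOf-⇔ (P? j)) (trans (sym eq) e))
                    (λ p → trans eq (bwd (bitOf-⇔ (P? j)) p))
      where
      eq : bits (tag l P?) j ≡ bitOf (P? j)
      eq = trans (cong (λ q → finToFun (proj₂ q) j) parts) (finToFun-funToFin (bitOf ∘ P?) j)

  funToFin-cong : ∀ {m n} {f g : Fin m → Fin n} → (∀ x → f x ≡ g x) → funToFin f ≡ funToFin g
  funToFin-cong {zero}  f≗g = refl
  funToFin-cong {suc m} f≗g = cong₂ combine (f≗g zero) (funToFin-cong (f≗g ∘ suc))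

  -- A pair label is determined by its base and its members, since an element of `Fin 2` is fixed by
  -- whether it equals `suc zero`. All later equations between computed labels reduce to
  -- equivalences of memberships in this way.
  ≡-tag : ∀ {P : Pred (Fin k) 0ℓ} {x l} (P? : Decidable₁ P) →
          base x ≡ l → (∀ j → j ∈ₗ x ⇔ P j) → x ≡ tag l P?
  ≡-tag {P} {x} {l} P? b≡l same = trans (sym (combine-remQuot {k} (2 ^ k) x))
    (cong₂ combine b≡l (trans (sym (funToFin-finToFin {m = k} {n = 2} (proj₂ (remQuot {k} (2 ^ k) x))))
                              (funToFin-cong λ j → bit-≡ (P? j) (same j))))
    where
    bit-≡ : ∀ {A : Set} {b : Fin 2} (A? : Dec A) → b ≡ suc zero ⇔ A → b ≡ bitOf A?
    bit-≡ (yes a) eq = bwd eq a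
    bit-≡ {b = zero} (no ¬a) eq = refl
    bit-≡ {b = suc zero} (no ¬a) eq = ⊥-elim (¬a (fwd eq refl))

-- Labelled graphs up to isomorphism, and those built by clique expressions.

infix 4 _≅_
-- An isomorphism of the quotients by `_≈_`: the two directions of `≈-⇔` make `map` well defined and
-- injective on classes, and `surj` makes it surjective on classes.
record _≅_ {n : ℕ} (X Y : LabelledGraph n) : Set where
  private
    module X = LabelledGraph X
    module Y = LabelledGraph Y
  field
    map     : X.Point → Y.Point
    ≈-⇔     : ∀ u v → u X.≈ v ⇔ map u Y.≈ map v
    surj    : ∀ y → ∃ λ x → map x Y.≈ y
    label-≡ : ∀ x → X.label x ≡ Y.label (map x)
    ~-⇔     : ∀ u v → u X.~ v ⇔ map u Y.~ map v

Builds : ∀ {n} → LabelledGraph n → Set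
Builds X = ∃ λ c → ⟦ c ⟧ᶜ ≅ X

module _ {n : ℕ} where

  open LabelledGraph using (Point)
  open _≅_

  isEquivalenceᶜ : (c : CliqueExpr n) → IsEquivalence (LabelledGraph._≈_ ⟦ c ⟧ᶜ)
  isEquivalenceᶜ (atom i)    = isEquivalence
  isEquivalenceᶜ (η i j _ c) = isEquivalenceᶜ c
  isEquivalenceᶜ (ρ i j c)   = isEquivalenceᶜ c
  isEquivalenceᶜ (c ⊕ d)     = ⊎-isEquivalence (isEquivalenceᶜ c) (isEquivalenceᶜ d)

  builds-≅ : ∀ {X Y : LabelledGraph n} → Transitive (LabelledGraph._≈_ Y) →
             X ≅ Y → Builds X → Builds Y
  builds-≅ ≈-trans g (c , f) = c , record
    { map     = map g ∘ map f
    ; ≈-⇔     = λ u v → ⇔-trans (≈-⇔ f u v) (≈-⇔ g _ _)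
    ; surj    = λ z → let (y , gy≈z) = surj g z ; (x , fx≈y) = surj f y in
                      x , ≈-trans (fwd (≈-⇔ g _ _) fx≈y) gy≈z
    ; label-≡ = λ x → trans (label-≡ f x) (label-≡ g _)
    ; ~-⇔     = λ u v → ⇔-trans (~-⇔ f u v) (~-⇔ g _ _)
    }

  builds-atom : (i : Fin n) → Builds (isolated i 1)
  builds-atom i = atom i , record
    { map     = id
    ; ≈-⇔     = λ _ _ → ⇔-refl
    ; surj    = λ y → y , refl
    ; label-≡ = λ _ → refl
    ; ~-⇔     = λ _ _ → ⇔-refl
    }

  builds-⊎ : ∀ {X Y : LabelledGraph n} → Builds X → Builds Y → Builds (disjointUnion X Y)
  builds-⊎ (c , f) (d , g) = c ⊕ d , record
    { map     = ⊎-map (map f) (map g)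
    ; ≈-⇔     = λ
        { (inj₁ u) (inj₁ v) → mk⇔ (λ { (inj₁ e) → inj₁ (fwd (≈-⇔ f u v) e) })
                                  (λ { (inj₁ e) → inj₁ (bwd (≈-⇔ f u v) e) })
        ; (inj₁ u) (inj₂ v) → mk⇔ (λ ()) (λ ())
        ; (inj₂ u) (inj₁ v) → mk⇔ (λ ()) (λ ())
        ; (inj₂ u) (inj₂ v) → mk⇔ (λ { (inj₂ e) → inj₂ (fwd (≈-⇔ g u v) e) })
                                  (λ { (inj₂ e) → inj₂ (bwd (≈-⇔ g u v) e) }) }
    ; surj    = λ { (inj₁ y) → let (x , e) = surj f y in inj₁ x , inj₁ e
                  ; (inj₂ y) → let (x , e) = surj g y in inj₂ x , inj₂ e }
    ; label-≡ = λ { (inj₁ x) → label-≡ f x ; (inj₂ x) → label-≡ g x }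
    ; ~-⇔     = λ
        { (inj₁ u) (inj₁ v) → mk⇔ (λ { (inj₁ e) → inj₁ (fwd (~-⇔ f u v) e) })
                                  (λ { (inj₁ e) → inj₁ (bwd (~-⇔ f u v) e) })
        ; (inj₁ u) (inj₂ v) → mk⇔ (λ ()) (λ ())
        ; (inj₂ u) (inj₁ v) → mk⇔ (λ ()) (λ ())
        ; (inj₂ u) (inj₂ v) → mk⇔ (λ { (inj₂ e) → inj₂ (fwd (~-⇔ g u v) e) })
                                  (λ { (inj₂ e) → inj₂ (bwd (~-⇔ g u v) e) }) }
    }

  Empty : LabelledGraph n → Set
  Empty X = ¬ Point X

  -- Every clique expression creates a vertex, so a graph without points has to be allowed
  -- separately. It arises when all vertices of a subexpression are fused later on.
  Builds⁰ : LabelledGraph n → Set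
  Builds⁰ X = Empty X ⊎ Builds X

  empty-⊎ : ∀ {X Y : LabelledGraph n} → Empty X → Builds Y → Builds (disjointUnion X Y)
  empty-⊎ ∄X (d , g) = d , record
    { map     = inj₂ ∘ map g
    ; ≈-⇔     = λ u v → mk⇔ (λ e → inj₂ (fwd (≈-⇔ g u v) e))
                            (λ { (inj₂ e) → bwd (≈-⇔ g u v) e })
    ; surj    = λ { (inj₁ x) → ⊥-elim (∄X x)
                  ; (inj₂ y) → let (x , e) = surj g y in x , inj₂ e }
    ; label-≡ = label-≡ g
    ; ~-⇔     = λ u v → mk⇔ (λ e → inj₂ (fwd (~-⇔ g u v) e))
                            (λ { (inj₂ e) → bwd (~-⇔ g u v) e })
    }

  ⊎-empty : ∀ {X Y : LabelledGraph n} → Builds X → Empty Y → Builds (disjointUnion X Y)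
  ⊎-empty (c , f) ∄Y = c , record
    { map     = inj₁ ∘ map f
    ; ≈-⇔     = λ u v → mk⇔ (λ e → inj₁ (fwd (≈-⇔ f u v) e))
                            (λ { (inj₁ e) → bwd (≈-⇔ f u v) e })
    ; surj    = λ { (inj₂ y) → ⊥-elim (∄Y y)
                  ; (inj₁ y) → let (x , e) = surj f y in x , inj₁ e }
    ; label-≡ = label-≡ f
    ; ~-⇔     = λ u v → mk⇔ (λ e → inj₁ (fwd (~-⇔ f u v) e))
                            (λ { (inj₁ e) → bwd (~-⇔ f u v) e })
    }

  builds⁰-⊎ : ∀ {X Y : LabelledGraph n} → Builds⁰ X → Builds⁰ Y → Builds⁰ (disjointUnion X Y)
  builds⁰-⊎ (inj₁ ∄X) (inj₁ ∄Y) = inj₁ [ ∄X , ∄Y ]′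
  builds⁰-⊎ (inj₁ ∄X) (inj₂ bY) = inj₂ (empty-⊎ ∄X bY)
  builds⁰-⊎ (inj₂ bX) (inj₁ ∄Y) = inj₂ (⊎-empty bX ∄Y)
  builds⁰-⊎ (inj₂ bX) (inj₂ bY) = inj₂ (builds-⊎ bX bY)

  builds⁰-≅ : ∀ {X Y : LabelledGraph n} → Transitive (LabelledGraph._≈_ Y) →
              X ≅ Y → Builds⁰ X → Builds⁰ Y
  builds⁰-≅ ≈-trans f = ⊎-map (λ ∄X y → ∄X (proj₁ (surj f y))) (builds-≅ ≈-trans f)

  -- Joining along a relation on labels.

  join : Rel (Fin n) 0ℓ → LabelledGraph n → LabelledGraph n
  join R X = record
    { Point = Point X
    ; _≈_   = _≈_
    ; label = label
    ; _~_   = λ u v → u ~ v ⊎ R (label u) (label v)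
    }
    where open LabelledGraph X using (_≈_; label; _~_)

  -- One `η` per listed pair: it needs two distinct labels and adds edges in both directions, whence
  -- the symmetrised membership.
  builds-join-list : ∀ {X} (L : List (Fin n × Fin n)) → (∀ {x y} → (x , y) ∈ L → x ≢ y) →
                     Builds X → Builds (join (λ x y → (x , y) ∈ L ⊎ (y , x) ∈ L) X)
  builds-join-list [] loopless (c , f) = c , record
    { map     = map f
    ; ≈-⇔     = ≈-⇔ f
    ; surj    = surj f
    ; label-≡ = label-≡ f
    ; ~-⇔     = λ u v → ⇔-trans (~-⇔ f u v)
        (mk⇔ inj₁ λ { (inj₁ e) → e ; (inj₂ (inj₁ ())) ; (inj₂ (inj₂ ())) })
    }
  builds-join-list {X} ((x , y) ∷ L) loopless b with c , f ← builds-join-list L (loopless ∘ there) b =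
    η x y (loopless (here refl)) c , record
    { map     = map f
    ; ≈-⇔     = ≈-⇔ f
    ; surj    = surj f
    ; label-≡ = label-≡ f
    ; ~-⇔     = λ u v → mk⇔
        [ ⊎-map id (⊎-map there there) ∘ fwd (~-⇔ f u v)
        , inj₂ ∘ ⊎-map (λ (p , q) → here (at p q)) (λ (p , q) → here (at q p)) ]′
        λ { (inj₁ e)                   → inj₁ (bwd (~-⇔ f u v) (inj₁ e))
          ; (inj₂ (inj₁ (here eq)))    → inj₂ (inj₁ (of eq))
          ; (inj₂ (inj₁ (there m)))    → inj₁ (bwd (~-⇔ f u v) (inj₂ (inj₁ m)))
          ; (inj₂ (inj₂ (here eq)))    → inj₂ (inj₂ (swap (of eq)))
          ; (inj₂ (inj₂ (there m)))    → inj₁ (bwd (~-⇔ f u v) (inj₂ (inj₂ m))) }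
    }
    where
    module X = LabelledGraph X
    open LabelledGraph ⟦ c ⟧ᶜ using (label)
    at : ∀ {u v} → label u ≡ x → label v ≡ y → (X.label (map f u) , X.label (map f v)) ≡ (x , y)
    at p q = cong₂ _,_ (trans (sym (label-≡ f _)) p) (trans (sym (label-≡ f _)) q)
    of : ∀ {u v} → (X.label (map f u) , X.label (map f v)) ≡ (x , y) → label u ≡ x × label v ≡ y
    of eq = trans (label-≡ f _) (cong proj₁ eq) , trans (label-≡ f _) (cong proj₂ eq)

  -- There are finitely many labels, so the related pairs can be listed; symmetry of `R` accounts
  -- for the reversed pairs.
  builds-join : ∀ {X} {R : Rel (Fin n) 0ℓ} → Decidable R → Symmetric R → Irreflexive _≡_ R →
                Builds X → Builds (join R X)
  builds-join {R = R} R? R-sym R-irrefl b = proj₁ joined , record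
    { map     = map f
    ; ≈-⇔     = ≈-⇔ f
    ; surj    = surj f
    ; label-≡ = label-≡ f
    ; ~-⇔     = λ u v → ⇔-trans (~-⇔ f u v) (mk⇔
        (⊎-map id [ ∈-R , R-sym ∘ ∈-R ]′)
        (⊎-map id (λ r → inj₁ (∈-filter⁺ R?′ (∈-cartesianProduct⁺ (∈-allFin _) (∈-allFin _)) r))))
    }
    where
    R?′ : Decidable₁ (λ (x , y) → R x y)
    R?′ (x , y) = R? x y
    pairs = cartesianProduct (allFin n) (allFin n)
    ∈-R : ∀ {x y} → (x , y) ∈ filter R?′ pairs → R x y
    ∈-R m = proj₂ (∈-filter⁻ R?′ {xs = pairs} m)
    joined = builds-join-list (filter R?′ pairs) (λ m eq → R-irrefl eq (∈-R m)) b
    f = proj₂ joined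

  -- Simultaneous relabelling by an idempotent function.

  relabelBy : (Fin n → Fin n) → LabelledGraph n → LabelledGraph n
  relabelBy f X = record
    { Point = Point X
    ; _≈_   = _≈_
    ; label = f ∘ label
    ; _~_   = _~_
    }
    where open LabelledGraph X using (_≈_; label; _~_)

  rename : Fin n → Fin n → Fin n → Fin n
  rename i j l = if does (l ≟ i) then j else l

  rename-idem : ∀ i j l → rename i j (rename i j l) ≡ rename i j l
  rename-idem i j l with l ≟ i
  rename-idem i j l | yes _ with j ≟ i
  ... | yes _ = refl
  ... | no _  = refl
  rename-idem i j l | no l≢i with l ≟ i
  ... | yes l≡i = ⊥-elim (l≢i l≡i)
  ... | no _    = refl

  renameAll : (Fin n → Fin n) → List (Fin n) → Fin n → Fin n
  renameAll f []       = id
  renameAll f (x ∷ xs) = rename x (f x) ∘ renameAll f xs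

  builds-renameAll : ∀ {X} f xs → Builds X → Builds (relabelBy (renameAll f xs) X)
  builds-renameAll f []       b = b
  builds-renameAll f (x ∷ xs) b with c , g ← builds-renameAll f xs b = ρ x (f x) c , record
    { map     = map g
    ; ≈-⇔     = ≈-⇔ g
    ; surj    = surj g
    ; label-≡ = λ v → cong (rename x (f x)) (label-≡ g v)
    ; ~-⇔     = ~-⇔ g
    }

  -- Idempotency excludes, for example, exchanging two labels, which
  -- could not be done one label at a time.

  module _ {f : Fin n → Fin n} (f-idem : ∀ l → f (f l) ≡ f l) where

    rename-fixes : ∀ x l → rename x (f x) (f l) ≡ f l
    rename-fixes x l with f l ≟ x
    ... | yes refl = f-idem l
    ... | no _     = refl

    rename-moves : ∀ x → rename x (f x) x ≡ f x
    rename-moves x with x ≟ x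
    ... | yes _  = refl
    ... | no x≢x = ⊥-elim (x≢x refl)

    rename-either : ∀ x l → rename x (f x) l ≡ l ⊎ rename x (f x) l ≡ f l
    rename-either x l with l ≟ x
    ... | yes refl = inj₂ refl
    ... | no _     = inj₁ refl

    -- The invariant of renaming one label at a time: a label has not moved yet or has arrived at
    -- its image. Images are fixed points of `f`, so a further renaming does not move them on.
    renameAll-either : ∀ xs l → renameAll f xs l ≡ l ⊎ renameAll f xs l ≡ f l
    renameAll-either []       l = inj₁ refl
    renameAll-either (x ∷ xs) l with renameAll-either xs l
    ... | inj₁ eq rewrite eq = rename-either x l
    ... | inj₂ eq rewrite eq = inj₂ (rename-fixes x l)

    renameAll-∈ : ∀ {xs l} → l ∈ xs → renameAll f xs l ≡ f l
    renameAll-∈ {x ∷ xs} {l} (here refl) with renameAll-either xs l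
    ... | inj₁ eq rewrite eq = rename-moves l
    ... | inj₂ eq rewrite eq = rename-fixes l l
    renameAll-∈ {x ∷ xs} {l} (there l∈xs) rewrite renameAll-∈ l∈xs = rename-fixes x l

    builds-relabelBy : ∀ {X} → Builds X → Builds (relabelBy f X)
    builds-relabelBy b with c , g ← builds-renameAll f (allFin n) b = c , record
      { map     = map g
      ; ≈-⇔     = ≈-⇔ g
      ; surj    = surj g
      ; label-≡ = λ v → trans (label-≡ g v) (renameAll-∈ (∈-allFin _))
      ; ~-⇔     = ~-⇔ g
      }

-- Equivalence, congruence and decidability for labelled graphs.

-- These are properties of the values of fusion expressions that `LabelledGraph` itself does not
-- demand. Decidability and `search` allow the set in the label of a vertex to be computed from its
-- neighbours.
record Regular {k : ℕ} (H : LabelledGraph k) : Set₁ where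
  open LabelledGraph H
  field
    ≈-isEquivalence : IsEquivalence _≈_
    _≈?_            : Decidable _≈_
    label-cong      : ∀ {u v} → u ≈ v → label u ≡ label v
    ~-sym           : Symmetric _~_
    ~-respˡ         : _~_ Respectsˡ _≈_
    _~?_            : Decidable _~_
    search          : ∀ {P : Pred Point 0ℓ} → Decidable₁ P → Dec (∃ P)
  module ≈ = IsEquivalence ≈-isEquivalence

  ~-resp : ∀ {u u′ v v′} → u ≈ u′ → v ≈ v′ → u ~ v → u′ ~ v′
  ~-resp u≈u′ v≈v′ = ~-respˡ u≈u′ ∘ ~-sym ∘ ~-respˡ v≈v′ ∘ ~-sym

module _ {k : ℕ} where

  regular-isolated : (i : Fin k) (m : ℕ) → Regular (isolated i m)
  regular-isolated i m = record
    { ≈-isEquivalence = isEquivalence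
    ; _≈?_            = _≟_
    ; label-cong      = λ _ → refl
    ; ~-sym           = λ ()
    ; ~-respˡ         = λ _ ()
    ; _~?_            = λ _ _ → no λ ()
    ; search          = any?
    }

  regular-connect : ∀ {H : LabelledGraph k} i j → Regular H → Regular (connect i j H)
  regular-connect {H} i j R = record
    { ≈-isEquivalence = ≈-isEquivalence
    ; _≈?_            = _≈?_
    ; label-cong      = label-cong
    ; ~-sym           = ⊎-map ~-sym [ inj₂ ∘ swap , inj₁ ∘ swap ]′
    ; ~-respˡ         = λ u≈v → ⊎-map (~-respˡ u≈v)
        (⊎-map (λ (p , q) → trans (sym (label-cong u≈v)) p , q)
               (λ (p , q) → trans (sym (label-cong u≈v)) p , q))
    ; _~?_            = λ u v → (u ~? v)
        ⊎-dec (label u ≟ i ×-dec label v ≟ j) ⊎-dec (label u ≟ j ×-dec label v ≟ i)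
    ; search          = search
    }
    where
    open LabelledGraph H using (label)
    open Regular R

  regular-relabel : ∀ {H : LabelledGraph k} i j → Regular H → Regular (relabel i j H)
  regular-relabel i j R = record
    { ≈-isEquivalence = ≈-isEquivalence
    ; _≈?_            = _≈?_
    ; label-cong      = cong (rename i j) ∘ label-cong
    ; ~-sym           = ~-sym
    ; ~-respˡ         = ~-respˡ
    ; _~?_            = _~?_
    ; search          = search
    }
    where open Regular R

  regular-⊎ : ∀ {G H : LabelledGraph k} → Regular G → Regular H → Regular (disjointUnion G H)
  regular-⊎ R S = record
    { ≈-isEquivalence = ⊎-isEquivalence R.≈-isEquivalence S.≈-isEquivalence
    ; _≈?_            = ⊎-decidable R._≈?_ S._≈?_
    ; label-cong      = λ { (inj₁ e) → R.label-cong e ; (inj₂ e) → S.label-cong e }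
    ; ~-sym           = ⊎-symmetric R.~-sym S.~-sym
    ; ~-respˡ         = λ { (inj₁ e) (inj₁ a) → inj₁ (R.~-respˡ e a)
                          ; (inj₂ e) (inj₂ a) → inj₂ (S.~-respˡ e a) }
    ; _~?_            = ⊎-decidable R._~?_ S._~?_
    ; search          = λ P? → map′ [ (λ (x , p) → inj₁ x , p) , (λ (y , p) → inj₂ y , p) ]′
        (λ { (inj₁ x , p) → inj₁ (x , p) ; (inj₂ y , p) → inj₂ (y , p) })
        (R.search (P? ∘ inj₁) ⊎-dec S.search (P? ∘ inj₂))
    }
    where
    module R = Regular R
    module S = Regular S

  -- Equality and adjacency before and after a fusion.

  module Fuse {H : LabelledGraph k} (i : Fin k) (R : Regular H) where
    open LabelledGraph H
    open Regular R
    open LabelledGraph (fuse i H) public using () renaming (_≈_ to _≈′_; _~_ to _~′_)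

    label-cong′ : ∀ {u v} → u ≈′ v → label u ≡ label v
    label-cong′ = [ label-cong , (λ (p , q) → trans p (sym q)) ]′

    ≈′-sym : ∀ {u v} → u ≈′ v → v ≈′ u
    ≈′-sym = ⊎-map ≈.sym swap

    ≈′-trans : ∀ {u v w} → u ≈′ v → v ≈′ w → u ≈′ w
    ≈′-trans (inj₁ e)       (inj₁ f)       = inj₁ (≈.trans e f)
    ≈′-trans (inj₁ e)       (inj₂ (q , r)) = inj₂ (trans (label-cong e) q , r)
    ≈′-trans (inj₂ (p , q)) f              = inj₂ (p , trans (sym (label-cong′ f)) q)

    _≈′?_ : Decidable _≈′_
    u ≈′? v = (u ≈? v) ⊎-dec (label u ≟ i ×-dec label v ≟ i)

    regular-fuse : Regular (fuse i H)
    regular-fuse = record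
      { ≈-isEquivalence = record { refl = inj₁ ≈.refl ; sym = ≈′-sym ; trans = ≈′-trans }
      ; _≈?_            = _≈′?_
      ; label-cong      = label-cong′
      ; ~-sym           = λ (¬ii , u′ , v′ , u≈u′ , v≈v′ , e) →
          ¬ii ∘ swap , v′ , u′ , v≈v′ , u≈u′ , ~-sym e
      ; ~-respˡ         = λ u≈w (¬ii , u′ , v′ , u≈u′ , v≈v′ , e) →
          (λ (p , q) → ¬ii (trans (label-cong′ u≈w) p , q))
          , u′ , v′ , ≈′-trans (≈′-sym u≈w) u≈u′ , v≈v′ , e
      ; _~?_            = λ u v → ¬? (label u ≟ i ×-dec label v ≟ i)
          ×-dec search (λ u′ → search λ v′ → (u ≈′? u′) ×-dec (v ≈′? v′) ×-dec (u′ ~? v′))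
      ; search          = search
      }

    ≈′⇒≈ : ∀ {u v} → label u ≢ i → u ≈′ v → u ≈ v
    ≈′⇒≈ u≢i = [ id , (λ (p , _) → ⊥-elim (u≢i p)) ]′

    ~⇔~′ : ∀ {u v} → label u ≢ i → label v ≢ i → u ~ v ⇔ u ~′ v
    ~⇔~′ u≢i v≢i = mk⇔
      (λ e → (λ (p , _) → u≢i p) , _ , _ , inj₁ ≈.refl , inj₁ ≈.refl , e)
      (λ (_ , _ , _ , u≈u′ , v≈v′ , e) →
        ~-resp (≈.sym (≈′⇒≈ u≢i u≈u′)) (≈.sym (≈′⇒≈ v≢i v≈v′)) e)

    -- Fusion may replace a neighbour of `u` by another point, but only by one with the same label.
    -- Hence the labels seen from an unfused vertex stay the same, even when `l` is `i`.
    neighbour-⇔ : ∀ {u l} → label u ≢ i →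
                  (∃ λ v → label v ≡ l × u ~ v) ⇔ (∃ λ v → label v ≡ l × u ~′ v)
    neighbour-⇔ u≢i = mk⇔
      (λ (v , q , e) → v , q , (λ (p , _) → u≢i p) , _ , _ , inj₁ ≈.refl , inj₁ ≈.refl , e)
      (λ (v , q , _ , _ , v′ , u≈u′ , v≈v′ , e) →
        v′ , trans (sym (label-cong′ v≈v′)) q , ~-respˡ (≈.sym (≈′⇒≈ u≢i u≈u′)) e)

  regularᶠ : (e : FusionExpr k) → Regular ⟦ e ⟧ᶠ
  regularᶠ (atom i m)  = regular-isolated i m
  regularᶠ (η i j _ e) = regular-connect i j (regularᶠ e)
  regularᶠ (ρ i j e)   = regular-relabel i j (regularᶠ e)
  regularᶠ (θ i e)     = Fuse.regular-fuse i (regularᶠ e)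
  regularᶠ (e ⊕ f)     = regular-⊎ (regularᶠ e) (regularᶠ f)

  -- The residue: the vertices that are not fused later on.

  open Encoding k

  module _ {H : LabelledGraph k} (R : Regular H) {F : Pred (Fin k) 0ℓ} (F? : Decidable₁ F) where
    open LabelledGraph H
    open Regular R

    Marked : Point → Pred (Fin k) 0ℓ
    Marked u l = F l × ∃ λ v → label v ≡ l × u ~ v

    marked? : ∀ u → Decidable₁ (Marked u)
    marked? u l = F? l ×-dec search (λ v → label v ≟ l ×-dec (u ~? v))

    -- This is the graph to be built for a subexpression when `F` holds of the labels awaiting
    -- fusion. Edges to vertices with labels in `F` survive only as marks. Points carry a proof that
    -- they lie outside `F`, but `_≈_` compares the vertices alone, so proofs never have to be
    -- compared.
    residue : LabelledGraph (k * 2 ^ k)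
    residue = record
      { Point = ∃ λ u → ¬ F (label u)
      ; _≈_   = λ u v → proj₁ u ≈ proj₁ v
      ; label = λ u → tag (label (proj₁ u)) (marked? (proj₁ u))
      ; _~_   = λ u v → proj₁ u ~ proj₁ v
      }

    base-residue : ∀ u → base (LabelledGraph.label residue u) ≡ label (proj₁ u)
    base-residue u = base-tag _ (marked? (proj₁ u))

    ∈-residue : ∀ u {l} → l ∈ₗ LabelledGraph.label residue u ⇔ Marked (proj₁ u) l
    ∈-residue u = ∈-tag _ (marked? (proj₁ u))

  -- Residues of atoms, disjoint unions, joins and relabellings.

  builds-isolated : ∀ {n} (i : Fin n) m .{{_ : NonZero m}} → Builds (isolated i m)
  builds-isolated i (suc zero)    = builds-atom i
  builds-isolated i (suc (suc m)) = builds-≅ trans record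
    { map     = [ (λ _ → zero) , suc ]′
    ; ≈-⇔     = λ
        { (inj₁ zero) (inj₁ zero) → mk⇔ (λ _ → refl) (λ _ → inj₁ refl)
        ; (inj₁ zero) (inj₂ v)    → mk⇔ (λ ()) (λ ())
        ; (inj₂ u)    (inj₁ v)    → mk⇔ (λ ()) (λ ())
        ; (inj₂ u)    (inj₂ v)    → mk⇔ (λ { (inj₂ e) → cong suc e }) (λ { refl → inj₂ refl }) }
    ; surj    = λ { zero → inj₁ zero , refl ; (suc v) → inj₂ v , refl }
    ; label-≡ = λ { (inj₁ _) → refl ; (inj₂ _) → refl }
    ; ~-⇔     = λ
        { (inj₁ u) (inj₁ v) → mk⇔ (λ { (inj₁ ()) }) (λ ())
        ; (inj₁ u) (inj₂ v) → mk⇔ (λ ()) (λ ())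
        ; (inj₂ u) (inj₁ v) → mk⇔ (λ ()) (λ ())
        ; (inj₂ u) (inj₂ v) → mk⇔ (λ { (inj₂ ()) }) (λ ()) }
    } (builds-⊎ (builds-atom i) (builds-isolated i (suc m)))

  module _ {F : Pred (Fin k) 0ℓ} (F? : Decidable₁ F) where

    -- All vertices share the label `i`, so the residue contains none or all of them; without edges
    -- every set of marks is empty.
    residue-isolated : ∀ i m .{{_ : NonZero m}} → Builds⁰ (residue (regular-isolated i m) F?)
    residue-isolated i m with F? i
    ... | yes Fi = inj₁ λ (_ , ¬Fi) → ¬Fi Fi
    ... | no ¬Fi = inj₂ (builds-≅ trans record
      { map     = λ v → v , ¬Fi
      ; ≈-⇔     = λ _ _ → ⇔-refl
      ; surj    = λ (v , _) → v , refl
      ; label-≡ = λ v → ≡-tag (marked? (regular-isolated i m) F? v) (base-tag i no-label?)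
          λ j → ⇔-trans (∈-tag i no-label?) (mk⇔ (λ ()) (λ ()))
      ; ~-⇔     = λ _ _ → ⇔-refl
      } (builds-isolated (tag i no-label?) m))
      where
      no-label? : Decidable₁ ∅
      no-label? _ = no λ ()

    -- No edge crosses between the two sides, so the marks of a vertex are the same in its side and
    -- in the union.
    residue-⊎ : ∀ {G H : LabelledGraph k} (R : Regular G) (S : Regular H) →
                disjointUnion (residue R F?) (residue S F?) ≅ residue (regular-⊎ R S) F?
    residue-⊎ {G} {H} R S = record
      { map     = [ (λ (u , ¬F) → inj₁ u , ¬F) , (λ (v , ¬F) → inj₂ v , ¬F) ]′
      ; ≈-⇔     = λ
          { (inj₁ u) (inj₁ v) → mk⇔ (λ { (inj₁ e) → inj₁ e }) (λ { (inj₁ e) → inj₁ e })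
          ; (inj₁ u) (inj₂ v) → mk⇔ (λ ()) (λ ())
          ; (inj₂ u) (inj₁ v) → mk⇔ (λ ()) (λ ())
          ; (inj₂ u) (inj₂ v) → mk⇔ (λ { (inj₂ e) → inj₂ e }) (λ { (inj₂ e) → inj₂ e }) }
      ; surj    = λ { (inj₁ u , ¬F) → inj₁ (u , ¬F) , inj₁ R.≈.refl
                    ; (inj₂ v , ¬F) → inj₂ (v , ¬F) , inj₂ S.≈.refl }
      ; label-≡ = λ
          { (inj₁ u) → ≡-tag (marked? RS F? _) (base-residue R F? u) λ l →
              ⇔-trans (∈-residue R F? u) (mk⇔
                (λ (Fl , v , q , e) → Fl , inj₁ v , q , inj₁ e)
                (λ { (Fl , inj₁ v , q , inj₁ e) → Fl , v , q , e }))
          ; (inj₂ u) → ≡-tag (marked? RS F? _) (base-residue S F? u) λ l →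
              ⇔-trans (∈-residue S F? u) (mk⇔
                (λ (Fl , v , q , e) → Fl , inj₂ v , q , inj₂ e)
                (λ { (Fl , inj₂ v , q , inj₂ e) → Fl , v , q , e })) }
      ; ~-⇔     = λ
          { (inj₁ u) (inj₁ v) → mk⇔ (λ { (inj₁ e) → inj₁ e }) (λ { (inj₁ e) → inj₁ e })
          ; (inj₁ u) (inj₂ v) → mk⇔ (λ ()) (λ ())
          ; (inj₂ u) (inj₁ v) → mk⇔ (λ ()) (λ ())
          ; (inj₂ u) (inj₂ v) → mk⇔ (λ { (inj₂ e) → inj₂ e }) (λ { (inj₂ e) → inj₂ e }) }
      }
      where
      module R = Regular R
      module S = Regular S
      RS = regular-⊎ R S

    module _ {H : LabelledGraph k} (R : Regular H) where
      open LabelledGraph H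
      open Regular R

      -- New edges inside the residue come from joining all pair labels with bases `i` and `j`. New
      -- edges to vertices awaiting fusion are only recorded, by relabelling with `mark`.
      residue-connect : ∀ i j → i ≢ j → Builds (residue R F?) →
                        Builds (residue (regular-connect i j R) F?)
      residue-connect i j i≢j b = builds-≅ ≈.trans record
        { map     = id
        ; ≈-⇔     = λ _ _ → ⇔-refl
        ; surj    = λ u → u , ≈.refl
        ; label-≡ = λ u → ≡-tag (marked? (regular-connect i j R) F? (proj₁ u))
            (trans (base-mark _) (base-residue R F? u))
            λ l → ⇔-trans (∈-mark _) (mk⇔
              [ (λ l∈u → let (Fl , v , q , e) = fwd (∈-residue R F? u) l∈u in Fl , v , q , inj₁ e)
              , (λ { (inj₁ (p , r) , Fl , v , q) → Fl , v , q , inj₂ (inj₁ (unbase u p , trans q r))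
                   ; (inj₂ (p , r) , Fl , v , q) → Fl , v , q , inj₂ (inj₂ (unbase u p , trans q r)) }) ]′
              (λ { (Fl , v , q , inj₁ e) → inj₁ (bwd (∈-residue R F? u) (Fl , v , q , e))
                 ; (Fl , v , q , inj₂ (inj₁ (p , r))) →
                     inj₂ (inj₁ (rebase u p , trans (sym q) r) , Fl , v , q)
                 ; (Fl , v , q , inj₂ (inj₂ (p , r))) →
                     inj₂ (inj₂ (rebase u p , trans (sym q) r) , Fl , v , q) }))
        ; ~-⇔     = λ u v → mk⇔
            (⊎-map id (⊎-map (λ (p , q) → unbase u p , unbase v q) (λ (p , q) → unbase u p , unbase v q)))
            (⊎-map id (⊎-map (λ (p , q) → rebase u p , rebase v q) (λ (p , q) → rebase u p , rebase v q)))
        } (builds-relabelBy mark-idem (builds-join joins? joins-sym joins-irrefl b))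
        where
        Joins : Rel PairLabel 0ℓ
        Joins x y = (base x ≡ i × base y ≡ j) ⊎ (base x ≡ j × base y ≡ i)
        joins? : Decidable Joins
        joins? x y = (base x ≟ i ×-dec base y ≟ j) ⊎-dec (base x ≟ j ×-dec base y ≟ i)
        joins-sym : Symmetric Joins
        joins-sym = [ inj₂ ∘ swap , inj₁ ∘ swap ]′
        joins-irrefl : Irreflexive _≡_ Joins
        joins-irrefl refl (inj₁ (p , q)) = i≢j (trans (sym p) q)
        joins-irrefl refl (inj₂ (p , q)) = i≢j (trans (sym q) p)

        unbase : ∀ u {l} → base (LabelledGraph.label (residue R F?) u) ≡ l → label (proj₁ u) ≡ l
        unbase u = trans (sym (base-residue R F? u))
        rebase : ∀ u {l} → label (proj₁ u) ≡ l → base (LabelledGraph.label (residue R F?) u) ≡ l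
        rebase u = trans (base-residue R F? u)

        -- l has to occur in H: otherwise a later ρ could turn the vacuous
        -- neighbour label into one that does occur.
        Gained : Fin k → Pred (Fin k) 0ℓ
        Gained b l = ((b ≡ i × l ≡ j) ⊎ (b ≡ j × l ≡ i)) × F l × ∃ λ v → label v ≡ l
        marks? : ∀ x → Decidable₁ (λ l → l ∈ₗ x ⊎ Gained (base x) l)
        marks? x l = l ∈ₗ? x ⊎-dec (((base x ≟ i ×-dec l ≟ j) ⊎-dec (base x ≟ j ×-dec l ≟ i))
          ×-dec F? l ×-dec search (λ v → label v ≟ l))
        mark : PairLabel → PairLabel
        mark x = tag (base x) (marks? x)
        base-mark : ∀ x → base (mark x) ≡ base x
        base-mark x = base-tag (base x) (marks? x)
        ∈-mark : ∀ x {l} → l ∈ₗ mark x ⇔ (l ∈ₗ x ⊎ Gained (base x) l)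
        ∈-mark x = ∈-tag (base x) (marks? x)
        -- What a label gains depends only on its base, which `mark` preserves.
        mark-idem : ∀ x → mark (mark x) ≡ mark x
        mark-idem x = ≡-tag (marks? x) (trans (base-mark (mark x)) (base-mark x)) λ l →
          ⇔-trans (∈-mark (mark x)) (mk⇔
            [ fwd (∈-mark x) , (λ g → inj₂ (subst (λ b → Gained b l) (base-mark x) g)) ]′
            (λ m → inj₁ (bwd (∈-mark x) m)))

    -- With the preimage of `F` under the renaming, the two residues have the same points. Only
    -- labels change: the base is renamed and the set is replaced by its image, an idempotent
    -- operation because `rename` is.
    residue-relabel : ∀ {H : LabelledGraph k} (R : Regular H) i j →
                      Builds (residue R {F ∘ rename i j} (F? ∘ rename i j)) → Builds (residue (regular-relabel i j R) F?)
    residue-relabel {H} R i j b = builds-≅ ≈.trans record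
      { map     = id
      ; ≈-⇔     = λ _ _ → ⇔-refl
      ; surj    = λ u → u , ≈.refl
      ; label-≡ = λ u → ≡-tag (marked? (regular-relabel i j R) F? (proj₁ u))
          (trans (base-image _) (cong r (base-residue R F∘r? u)))
          λ l → ⇔-trans (∈-image _) (mk⇔
            (λ (m , m∈u , rm≡l) → let (Frm , v , q , e) = fwd (∈-residue R F∘r? u) m∈u in
              subst F rm≡l Frm , v , trans (cong r q) rm≡l , e)
            (λ (Fl , v , q , e) →
              -- The preimage of `l` is the label that the neighbour `v` had before the renaming.
              label v , bwd (∈-residue R F∘r? u) (subst F (sym q) Fl , v , refl , e) , q))
      ; ~-⇔     = λ _ _ → ⇔-refl
      } (builds-relabelBy image-idem b)
      where
      open LabelledGraph H
      open Regular R
      r = rename i j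
      F∘r? : Decidable₁ (F ∘ r)
      F∘r? = F? ∘ r
      images? : ∀ x → Decidable₁ (λ l → ∃ λ m → m ∈ₗ x × r m ≡ l)
      images? x l = any? λ m → m ∈ₗ? x ×-dec r m ≟ l
      image : PairLabel → PairLabel
      image x = tag (r (base x)) (images? x)
      base-image : ∀ x → base (image x) ≡ r (base x)
      base-image x = base-tag (r (base x)) (images? x)
      ∈-image : ∀ x {l} → l ∈ₗ image x ⇔ (∃ λ m → m ∈ₗ x × r m ≡ l)
      ∈-image x = ∈-tag (r (base x)) (images? x)
      image-idem : ∀ x → image (image x) ≡ image x
      image-idem x = ≡-tag (images? x)
        (trans (base-image (image x)) (trans (cong r (base-image x)) (rename-idem i j (base x))))
        λ l → ⇔-trans (∈-image (image x)) (mk⇔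
          (λ (m , m∈ , rm≡l) → let (m′ , m′∈ , rm′≡m) = fwd (∈-image x) m∈ in
            m′ , m′∈ , trans (sym (rename-idem i j m′)) (trans (cong r rm′≡m) rm≡l))
          (λ (m , m∈ , rm≡l) → r m , bwd (∈-image x) (m , m∈ , refl)
                             , trans (rename-idem i j m) rm≡l))

    -- Residues under fusion.

    module _ {H : LabelledGraph k} (i : Fin k) (R : Regular H) where
      open LabelledGraph H
      open Regular R
      open Fuse i R

      -- Below `θ i` the label `i` awaits fusion as well.
      F⁺ : Pred (Fin k) 0ℓ
      F⁺ l = l ≡ i ⊎ F l

      F⁺? : Decidable₁ F⁺
      F⁺? l = l ≟ i ⊎-dec F? l

      -- Any vertex labelled `i` still awaits a later fusion, so none has to be created now. On the
      -- vertices that occur, `F` and `F⁺` agree, and fusion alters nothing away from the label `i`.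
      residue-fuse-stable : (∀ u → label u ≡ i → F i) → residue R F⁺? ≅ residue regular-fuse F?
      residue-fuse-stable i⇒F = record
        { map     = λ (u , ¬F⁺) → u , ¬F⁺ ∘ inj₂
        ; ≈-⇔     = λ (_ , ¬F⁺) _ → mk⇔ inj₁ (≈′⇒≈ (¬F⁺ ∘ inj₁))
        ; surj    = λ (u , ¬F) → (u , [ (λ u≡i → ¬F (subst F (sym u≡i) (i⇒F u u≡i))) , ¬F ]′)
                               , inj₁ ≈.refl
        ; label-≡ = λ (u , ¬F⁺) → ≡-tag (marked? regular-fuse F? u) (base-residue R F⁺? (u , ¬F⁺))
            λ l → ⇔-trans (∈-residue R F⁺? (u , ¬F⁺)) (mk⇔
              -- A mark at `i` comes with a neighbour labelled `i`, so the hypothesis puts `i` into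
              -- `F`.
              (λ { (inj₁ refl , v , q , e) → i⇒F v q , fwd (neighbour-⇔ (¬F⁺ ∘ inj₁)) (v , q , e)
                 ; (inj₂ Fl , nb) → Fl , fwd (neighbour-⇔ (¬F⁺ ∘ inj₁)) nb })
              (λ (Fl , nb) → inj₂ Fl , bwd (neighbour-⇔ (¬F⁺ ∘ inj₁)) nb))
        ; ~-⇔     = λ (_ , ¬F⁺) (_ , ¬G⁺) → ~⇔~′ (¬F⁺ ∘ inj₁) (¬G⁺ ∘ inj₁)
        }

      -- This is the last fusion of these vertices: add one vertex labelled `new`, join it to the
      -- vertices marked with `i`, then strike `i` from every set because it no longer awaits
      -- fusion. Fusion identifies all points labelled `i`, so `w` can stand for the merged vertex.
      residue-fuse-new : ∀ w → label w ≡ i → ¬ F i → Builds⁰ (residue R F⁺?) →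
                         Builds (residue regular-fuse F?)
      residue-fuse-new w w≡i ¬Fi b⁰ = builds-≅ ≈′-trans record
        { map     = place
        ; ≈-⇔     = λ
            { (inj₁ (_ , ¬F⁺)) (inj₁ _) → mk⇔ (λ { (inj₁ e) → inj₁ e })
                                              (inj₁ ∘ ≈′⇒≈ (¬F⁺ ∘ inj₁))
            ; (inj₁ (_ , ¬F⁺)) (inj₂ _) → mk⇔ (λ ())
                (λ e → ⊥-elim (¬F⁺ (inj₁ (trans (label-cong′ e) w≡i))))
            ; (inj₂ _) (inj₁ (_ , ¬F⁺)) → mk⇔ (λ ())
                (λ e → ⊥-elim (¬F⁺ (inj₁ (trans (sym (label-cong′ e)) w≡i))))
            ; (inj₂ zero) (inj₂ zero)   → mk⇔ (λ _ → inj₁ ≈.refl) (λ _ → inj₂ refl) }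
        ; surj    = λ (u , ¬F) → case label u ≟ i of λ
            { (yes u≡i) → inj₂ zero , inj₂ (w≡i , u≡i)
            ; (no u≢i)  → inj₁ (u , [ u≢i , ¬F ]′) , inj₁ ≈.refl }
        ; label-≡ = λ
            { (inj₁ (u , ¬F⁺)) → ≡-tag (marked? regular-fuse F? u)
                (trans (base-forget _) (base-residue R F⁺? (u , ¬F⁺)))
                λ l → ⇔-trans (∈-forget _) (mk⇔
                  (λ (l∈u , l≢i) → let (F⁺l , nb) = fwd (∈-residue R F⁺? (u , ¬F⁺)) l∈u in
                    [ ⊥-elim ∘ l≢i , id ]′ F⁺l , fwd (neighbour-⇔ (¬F⁺ ∘ inj₁)) nb)
                  (λ (Fl , nb) →
                    bwd (∈-residue R F⁺? (u , ¬F⁺)) (inj₂ Fl , bwd (neighbour-⇔ (¬F⁺ ∘ inj₁)) nb)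
                    , F⇒≢i Fl))
            ; (inj₂ _) → ≡-tag (marked? regular-fuse F? w)
                (trans (base-forget _) (trans base-new (sym w≡i)))
                λ l → ⇔-trans (∈-forget _) (mk⇔
                  -- As `l` differs from `i`, the neighbour `v` is not merged, and the edge is not
                  -- discarded as a loop.
                  (λ (l∈new , l≢i) → let (Fl , u , v , u≡i , v≡l , e) = fwd ∈-new l∈new in
                    Fl , v , v≡l , (λ (_ , v≡i) → l≢i (trans (sym v≡l) v≡i))
                    , u , v , inj₂ (w≡i , u≡i) , inj₁ ≈.refl , e)
                  (λ (Fl , v , v≡l , _ , u , v′ , w≈u , v≈v′ , e) →
                    bwd ∈-new (Fl , u , v′ , trans (sym (label-cong′ w≈u)) w≡i
                                  , trans (sym (label-cong′ v≈v′)) v≡l , e)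
                    , F⇒≢i Fl)) }
        ; ~-⇔     = λ
            { (inj₁ (u , ¬F⁺)) (inj₁ (v , ¬G⁺)) → ⇔-trans
                (mk⇔ [ (λ { (inj₁ e) → e })
                     -- No vertex of the inner residue has base `i`, so the join adds nothing
                     -- between two of them.
                     , [ (λ (p , _) → ⊥-elim (¬F⁺ (inj₁ (unbase (u , ¬F⁺) p))))
                       , (λ (p , _) → ⊥-elim (¬G⁺ (inj₁ (unbase (v , ¬G⁺) p)))) ]′ ]′
                     (λ e → inj₁ (inj₁ e)))
                (~⇔~′ (¬F⁺ ∘ inj₁) (¬G⁺ ∘ inj₁))
            ; (inj₁ u) (inj₂ _) → mk⇔
                [ (λ ())
                , [ (λ (p , _) → ⊥-elim (proj₂ u (inj₁ (unbase u p))))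
                  , (λ (_ , _ , i∈u) → Regular.~-sym regular-fuse (fwd (∈⇔~ u) i∈u)) ]′ ]′
                (λ e → inj₂ (inj₂ (joins-new u (Regular.~-sym regular-fuse e))))
            ; (inj₂ _) (inj₁ v) → mk⇔
                [ (λ ())
                , [ (λ (_ , _ , i∈v) → fwd (∈⇔~ v) i∈v)
                  , (λ (p , _) → ⊥-elim (proj₂ v (inj₁ (unbase v p)))) ]′ ]′
                (λ e → inj₂ (inj₁ (joins-new v e)))
            ; (inj₂ _) (inj₂ _) → mk⇔
                [ (λ { (inj₂ ()) }) , ⊥-elim ∘ joins-irrefl refl ]′
                (λ (¬ii , _) → ⊥-elim (¬ii (w≡i , w≡i))) }
        } (builds-relabelBy forget-idem (builds-join joins? ⊎-swap joins-irrefl with-new))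
        where
        F⇒≢i : ∀ {l} → F l → l ≢ i
        F⇒≢i Fl refl = ¬Fi Fl

        place : LabelledGraph.Point (residue R F⁺?) ⊎ Fin 1 → ∃ λ u → ¬ F (label u)
        place (inj₁ (u , ¬F⁺)) = u , ¬F⁺ ∘ inj₂
        place (inj₂ _)         = w , λ Fw → F⇒≢i Fw w≡i

        -- The merged vertex inherits the neighbours of all vertices labelled `i`, so its marks are
        -- collected over all of them. Restricting to `F` leaves out `i`.
        new? : Decidable₁ (λ l → F l × ∃ λ u → ∃ λ v → label u ≡ i × label v ≡ l × u ~ v)
        new? l = F? l ×-dec search λ u → search λ v → label u ≟ i ×-dec label v ≟ l ×-dec (u ~? v)
        new : PairLabel
        new = tag i new?
        base-new : base new ≡ i
        base-new = base-tag i new?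
        ∈-new : ∀ {l} → l ∈ₗ new ⇔ (F l × ∃ λ u → ∃ λ v → label u ≡ i × label v ≡ l × u ~ v)
        ∈-new = ∈-tag i new?
        with-new : Builds (disjointUnion (residue R F⁺?) (isolated new 1))
        with-new = [ (λ ∄u → empty-⊎ ∄u (builds-atom new)) , (λ b → builds-⊎ b (builds-atom new)) ]′ b⁰

        -- Here `x` is meant to be `new`, whose vertex is the only one with base `i` at this moment.
        -- Requiring another base for `y` makes the relation irreflexive, as joining demands.
        Meets : Rel PairLabel 0ℓ
        Meets x y = base x ≡ i × base y ≢ i × i ∈ₗ y
        meets? : Decidable Meets
        meets? x y = base x ≟ i ×-dec ¬? (base y ≟ i) ×-dec i ∈ₗ? y
        Joins : Rel PairLabel 0ℓ
        Joins x y = Meets x y ⊎ Meets y x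
        joins? : Decidable Joins
        joins? x y = meets? x y ⊎-dec meets? y x
        joins-irrefl : Irreflexive _≡_ Joins
        joins-irrefl refl (inj₁ (p , q , _)) = q p
        joins-irrefl refl (inj₂ (p , q , _)) = q p

        unbase : ∀ u {l} → base (LabelledGraph.label (residue R F⁺?) u) ≡ l → label (proj₁ u) ≡ l
        unbase u = trans (sym (base-residue R F⁺? u))
        -- A mark at `i` records adjacency to some vertex labelled `i`, which after fusion is
        -- adjacency to the merged vertex.
        ∈⇔~ : ∀ u → i ∈ₗ LabelledGraph.label (residue R F⁺?) u ⇔ w ~′ proj₁ u
        ∈⇔~ (u , ¬F⁺) = ⇔-trans (∈-residue R F⁺? (u , ¬F⁺)) (mk⇔
          (λ (_ , v , v≡i , e) → (λ (_ , u≡i) → ¬F⁺ (inj₁ u≡i))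
            , v , u , inj₂ (w≡i , v≡i) , inj₁ ≈.refl , ~-sym e)
          (λ (_ , v , u′ , w≈v , u≈u′ , e) → inj₁ refl , v , trans (sym (label-cong′ w≈v)) w≡i
            , ~-respˡ (≈.sym (≈′⇒≈ (¬F⁺ ∘ inj₁) u≈u′)) (~-sym e)))
        joins-new : ∀ u → w ~′ proj₁ u → Meets new (LabelledGraph.label (residue R F⁺?) u)
        joins-new u e = base-new , (λ p → proj₂ u (inj₁ (unbase u p))) , bwd (∈⇔~ u) e

        kept? : ∀ x → Decidable₁ (λ l → l ∈ₗ x × l ≢ i)
        kept? x l = l ∈ₗ? x ×-dec ¬? (l ≟ i)
        forget : PairLabel → PairLabel
        forget x = tag (base x) (kept? x)
        base-forget : ∀ x → base (forget x) ≡ base x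
        base-forget x = base-tag (base x) (kept? x)
        ∈-forget : ∀ x {l} → l ∈ₗ forget x ⇔ (l ∈ₗ x × l ≢ i)
        ∈-forget x = ∈-tag (base x) (kept? x)
        forget-idem : ∀ x → forget (forget x) ≡ forget x
        forget-idem x = ≡-tag (kept? x) (trans (base-forget (forget x)) (base-forget x)) λ l →
          ⇔-trans (∈-forget (forget x)) (mk⇔
            (λ (l∈ , _) → fwd (∈-forget x) l∈)
            (λ m → bwd (∈-forget x) m , proj₂ m))

      -- A vertex is created exactly when some vertex is labelled `i` and `i` awaits no later
      -- fusion.
      residue-fuse : Builds⁰ (residue R F⁺?) → Builds⁰ (residue regular-fuse F?)
      residue-fuse b with search (λ u → label u ≟ i) | F? i
      ... | yes (w , w≡i) | no ¬Fi = inj₂ (residue-fuse-new w w≡i ¬Fi b)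
      ... | yes _         | yes Fi = builds⁰-≅ ≈′-trans (residue-fuse-stable λ _ _ → Fi) b
      ... | no ∄u         | _      =
        builds⁰-≅ ≈′-trans (residue-fuse-stable λ u u≡i → ⊥-elim (∄u (u , u≡i))) b

  -- Induction on fusion-tree expressions and the resulting bound.

  builds-residue : (e : FusionExpr k) {F : Pred (Fin k) 0ℓ} (F? : Decidable₁ F) →
                   Builds⁰ (residue (regularᶠ e) F?)
  builds-residue (atom i m)    F? = residue-isolated F? i m
  builds-residue (η i j i≢j e) F? =
    -- Both residues have the same points, so emptiness carries over by `id`; likewise for `ρ`.
    ⊎-map id (residue-connect F? (regularᶠ e) i j i≢j) (builds-residue e F?)
  builds-residue (ρ i j e) {F} F? =
    ⊎-map id (residue-relabel F? (regularᶠ e) i j) (builds-residue e {F ∘ rename i j} (F? ∘ rename i j))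
  builds-residue (θ i e)       F? =
    residue-fuse F? i (regularᶠ e) (builds-residue e (F⁺? F? i (regularᶠ e)))
  builds-residue (e ⊕ f)       F? = builds⁰-≅ (Regular.≈.trans (regularᶠ (e ⊕ f)))
    (residue-⊎ F? (regularᶠ e) (regularᶠ f))
    (builds⁰-⊎ (builds-residue e F?) (builds-residue f F?))

-- At the root no label awaits fusion, so the residue for the empty `F` keeps all vertices and
-- edges. It has a point because graphs are nonempty.
clique-from-fusion : ∀ G k → HasFusionExpr G k → HasCliqueExpr G (k * 2 ^ k)
clique-from-fusion G k (e , gen) with builds-residue e {∅} (λ _ → no λ ())
... | inj₁ ∄u = ⊥-elim (∄u (hit (vertex _) , λ ()))
  where
  open _Generates_ gen
  vertex : ∀ n .{{_ : NonZero n}} → Fin n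
  vertex (suc n) = zero
  hit : Fin (Graph.order G) → LabelledGraph.Point ⟦ e ⟧ᶠ
  hit x = proj₁ (proj₂ bijective x)
... | inj₂ (c , f) = c , record
  { to        = to ∘ place
  ; to-cong   = λ x≈y → to-cong (fwd (≈-⇔ _ _) x≈y)
  ; bijective = (λ x≡y → bwd (≈-⇔ _ _) (proj₁ bijective x≡y))
              , λ y → let (u , hit) = proj₂ bijective y ; (x , x≈u) = surj (u , λ ()) in
                      x , λ z≈x → hit (≈.trans (fwd (≈-⇔ _ _) z≈x) x≈u)
  ; ~-⇔       = λ x y → ⇔-trans (f-~-⇔ x y) (~-⇔ _ _)
  }
  where
  open _Generates_ gen
  open _≅_ f using (map; ≈-⇔; surj) renaming (~-⇔ to f-~-⇔)
  open Regular (regularᶠ e) using (module ≈)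
  place : LabelledGraph.Point ⟦ c ⟧ᶜ → LabelledGraph.Point ⟦ e ⟧ᶠ
  place = proj₁ ∘ map

theorem4 : (G : Graph) (k : ℕ) → IsFusionWidth G k → cw G ≤ k * 2 ^ k
theorem4 G k (fusion , _) = proj₂ (cw-isCliqueWidth G) (clique-from-fusion G k fusion)
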